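{- Let $n\ge 3$, $1\le t<n$, and let $c_1,c_2,\ldots,c_t\in[n]$ be distinct integers such that the sequence $(c_1,\ldots,c_t)$ avoids both patterns $3412$ and $3421$. Let $$U=\{c_i: i\in[t]\text{ and there exist } j,k\in[t]\text{ such that } i<j<k\text{ and } c_ic_jc_k\text{ is a }231\text{ pattern}\}$$ and $$V=\{c_i: i\in[t]\text{ and there exists } j\in[t]\text{ such that } i<j\text{ and } c_i<c_j\}.$$ If ($U\ne\emptyset$ and $|[\max U]\setminus\{c_1,\ldots,c_t\}|\ge1$) or ($V\neq\emptyset$ and $|[\max V]\setminus\{c_1,\ldots,c_t\}|\ge2$), then $|S_{n,(c_1,\ldots,c_t)}(3412,3421)|=0$; otherwise, $$|S_{n,(c_1,\ldots,c_t)}(3412,3421)|=\mathbb{S}_{c_{(j)}-c_{(j-1)}-2}\prod_{i=j+1}^{t+1}\mathbb{S}_{c_{(i)}-c_{(i-1)}-1},$$ where $c_{(0)}=0$, $c_{(t+1)}=n+1$, $c_{(1)}<c_{(2)}<\cdots<c_{(t)}$ are the elements of $\{c_1,\ldots,c_t\}$ in increasing order, $j=\min\{i\in[t+1]:c_{(i)}-c_{(i-1)}>1\}$, and $\mathbb{S}_m$ is the $m$th large Schr\"oder number.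
   Context: $[n]=\{1,\ldots,n\}$ and $S_n$ is the set of permutations of $[n]$ written as sequences $(\tau(1),\ldots,\tau(n))$. A sequence of distinct integers $\tau=(\tau(1),\ldots,\tau(m))$ contains $\sigma\in S_k$ as a pattern if there are indices $1\le i_1<\cdots<i_k\le m$ such that for all $1\le a<b\le k$, $\tau(i_a)<\tau(i_b)$ if and only if $\sigma(a)<\sigma(b)$ (then $\tau(i_1)\cdots\tau(i_k)$ is called a $\sigma$ pattern); otherwise $\tau$ avoids $\sigma$. $S_{n,(c_1,\ldots,c_t)}(\sigma_1,\ldots,\sigma_m)$ is the set of $\tau\in S_n$ with $(\tau(1),\ldots,\tau(t))=(c_1,\ldots,c_t)$ that avoid all of $\sigma_1,\ldots,\sigma_m$. The large (big) Schr\"oder number $\mathbb{S}_m$, $m\ge0$, is the number of lattice paths from $(0,0)$ to $(m,m)$ with steps $(1,0),(0,1),(1,1)$ that never go above the line $y=x$; the sequence begins $\mathbb{S}_0=1,\ \mathbb{S}_1=2,\ \mathbb{S}_2=6,\ \mathbb{S}_3=22,\ \mathbb{S}_4=90,\ldots$ (OEIS A006318). -}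

module Defs where

open import Data.Fin.Base as Fin using (Fin)
open import Data.List.Base
  using (List; []; _∷_; _++_; applyUpTo; drop; filter; head; inits; length;
         lookup; map; product; take)
import Data.List.Membership.DecPropositional as DecMembership
open import Data.List.Membership.Propositional using (_∈_)
open import Data.List.Membership.Propositional.Properties
  using (∈-++⁺ˡ; ∈-++⁺ʳ; ∈-++⁻; ∈-filter⁺; ∈-filter⁻; ∈-map⁺; ∈-map⁻)
open import Data.List.Relation.Binary.Disjoint.Propositional using (Disjoint)
open import Data.List.Relation.Binary.Permutation.Propositional using (_↭_)
open import Data.List.Relation.Unary.All as All using (All; []; _∷_)
open import Data.List.Relation.Unary.AllPairs using ([]; _∷_)
open import Data.List.Relation.Unary.Any using (here; there)
open import Data.List.Relation.Unary.Unique.Propositional using (Unique)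
import Data.List.Relation.Unary.Unique.Propositional.Properties as Unique
import Data.List.Sort as Sort
open import Data.Maybe.Base using (fromMaybe; just; nothing)
open import Data.Maybe.Properties using (just-injective)
open import Data.Nat.Base
open import Data.Nat.Properties
  using (_≟_; _≤?_; ≤-decTotalOrder; module ≤-Reasoning; +-suc; n≤1+n;
         +-monoʳ-≤)
open import Data.Product.Base using (∃; _×_; _,_; proj₁; proj₂)
open import Data.Product.Properties using (≡-dec)
open import Data.Sum.Base using (inj₁; inj₂)
open import Function.Base using (_∘_)
open import Function.Bundles using (_⇔_; mk⇔)
open import Level using (0ℓ)
open import Relation.Binary.PropositionalEquality
  using (_≡_; _≢_; refl; sym; trans; cong; cong₂)
open import Relation.Nullary.Decidable using (_×-dec_)
open import Relation.Nullary.Negation using (¬_)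
open import Relation.Unary using (Decidable; Pred)

------------------------------------------------------------------------
-- Cardinality, extrema, finite products

-- X is finite with exactly N elements: it is enumerated without
-- repetition by a list of length N.
HasSize : {A : Set} → Pred A 0ℓ → ℕ → Set
HasSize X N =
  ∃ λ xs → Unique xs × (∀ x → x ∈ xs ⇔ X x) × length xs ≡ N

-- A set of naturals bounded above has a maximum exactly when it is
-- nonempty, so "X ≠ ∅ and P (max X)" reads ∃ λ m → IsMax X m × P m.
IsMax : Pred ℕ 0ℓ → ℕ → Set
IsMax X m = X m × (∀ x → X x → x ≤ m)

IsMin : Pred ℕ 0ℓ → ℕ → Set
IsMin X m = X m × (∀ x → X x → m ≤ x)

[1⋯_] : ℕ → List ℕ
[1⋯ n ] = applyUpTo suc n

-- f a * f (a + 1) * ⋯ * f b, which is 1 when b < a.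
∏[_⋯_] : ℕ → ℕ → (ℕ → ℕ) → ℕ
∏[ a ⋯ b ] f = product (applyUpTo (λ k → f (a + k)) (suc b ∸ a))

-- The number of elements of [m] that are not entries of c.
missing : ℕ → List ℕ → ℕ
missing m c = length (filter (_∉? c) [1⋯ m ])
  where open DecMembership _≟_ using (_∉?_)

------------------------------------------------------------------------
-- Patterns

-- ι lists the positions i₁ < ⋯ < i_k at which τ has a σ pattern.
IsOccurrence : (σ τ : List ℕ) → (Fin (length σ) → Fin (length τ)) → Set
IsOccurrence σ τ ι = ∀ {a b} → a Fin.< b →
  (ι a Fin.< ι b) ×
  (lookup τ (ι a) < lookup τ (ι b) ⇔ lookup σ a < lookup σ b)

_Contains_ : List ℕ → List ℕ → Set
τ Contains σ = ∃ (IsOccurrence σ τ)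

_Avoids_ : List ℕ → List ℕ → Set
τ Avoids σ = ¬ (τ Contains σ)

231-pattern 3412-pattern 3421-pattern : List ℕ
231-pattern  = 2 ∷ 3 ∷ 1 ∷ []
3412-pattern = 3 ∷ 4 ∷ 1 ∷ 2 ∷ []
3421-pattern = 3 ∷ 4 ∷ 2 ∷ 1 ∷ []

-- S n c σs is the set of permutations of [n], in one-line notation, that
-- begin with c and avoid every pattern in σs.
S : ℕ → List ℕ → List (List ℕ) → Pred (List ℕ) 0ℓ
S n c σs τ = (τ ↭ [1⋯ n ]) × (take (length c) τ ≡ c) × All (τ Avoids_) σs

U : List ℕ → Pred ℕ 0ℓ
U c x = ∃ λ ι → IsOccurrence 231-pattern c ι × lookup c (ι Fin.zero) ≡ x

V : List ℕ → Pred ℕ 0ℓ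
V c x = ∃ λ i → ∃ λ j →
  (i Fin.< j) × (lookup c i < lookup c j) × lookup c i ≡ x

-- For 1 ≤ i ≤ length c this is the i-th smallest entry c₍ᵢ₎ of c. The
-- boundary conventions are c₍₀₎ = 0 and, through the default value,
-- c₍ᵢ₎ = n + 1 for i = length c + 1.
ordered : ℕ → List ℕ → ℕ → ℕ
ordered n c zero    = 0
ordered n c (suc i) = fromMaybe (suc n) (head (drop i (sort c)))
  where open Sort ≤-decTotalOrder using (sort)

-- c₍ᵢ₎ - c₍ᵢ₋₁₎, meant for 1 ≤ i ≤ length c + 1.
gap : ℕ → List ℕ → ℕ → ℕ
gap n c i = ordered n c i ∸ ordered n c (i ∸ 1)

------------------------------------------------------------------------
-- Large Schröder numbers

data Step : Set where
  east north diagonal : Step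

end : List Step → ℕ × ℕ
end []             = 0 , 0
end (east ∷ w)     = let (x , y) = end w in suc x , y
end (north ∷ w)    = let (x , y) = end w in x , suc y
end (diagonal ∷ w) = let (x , y) = end w in suc x , suc y

-- The points visited by a path are the ends of its initial segments.
NotAbove : Pred (List Step) 0ℓ
NotAbove w = proj₂ (end w) ≤ proj₁ (end w)

SchröderPath : ℕ → Pred (List Step) 0ℓ
SchröderPath m w = end w ≡ (m , m) × All NotAbove (inits w)

schröderPath? : ∀ m → Decidable (SchröderPath m)
schröderPath? m w =
  ≡-dec _≟_ _≟_ (end w) (m , m) ×-dec
  All.all? (λ v → proj₂ (end v) ≤? proj₁ (end v)) (inits w)

-- All step sequences of length at most k.
words : ℕ → List (List Step)
words zero    = [] ∷ []
words (suc k) = [] ∷ map (east ∷_) (words k)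
                  ++ map (north ∷_) (words k)
                  ++ map (diagonal ∷_) (words k)

-- A path to (m , m) has at most 2m steps.
schröderPaths : ℕ → List (List Step)
schröderPaths m = filter (schröderPath? m) (words (m + m))

𝕊 : ℕ → ℕ
𝕊 m = length (schröderPaths m)

words-complete : ∀ k w → length w ≤ k → w ∈ words k
words-complete zero    []             _         = here refl
words-complete (suc k) []             _         = here refl
words-complete (suc k) (east ∷ w)     (s≤s w≤k) =
  there (∈-++⁺ˡ (∈-map⁺ (east ∷_) (words-complete k w w≤k)))
words-complete (suc k) (north ∷ w)    (s≤s w≤k) =
  there (∈-++⁺ʳ (map (east ∷_) (words k))
    (∈-++⁺ˡ (∈-map⁺ (north ∷_) (words-complete k w w≤k))))
words-complete (suc k) (diagonal ∷ w) (s≤s w≤k) =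
  there (∈-++⁺ʳ (map (east ∷_) (words k))
    (∈-++⁺ʳ (map (north ∷_) (words k))
      (∈-map⁺ (diagonal ∷_) (words-complete k w w≤k))))

private
  ∷-injʳ : ∀ {s} {v w : List Step} → s ∷ v ≡ s ∷ w → v ≡ w
  ∷-injʳ refl = refl

  heads : ∀ {s : Step} ws {w} → w ∈ map (s ∷_) ws → head w ≡ just s
  heads {s} ws w∈ with _ , _ , refl ← ∈-map⁻ (s ∷_) w∈ = refl

  apart : ∀ {s s′ : Step} ws {w} → s ≢ s′ → w ∈ map (s ∷_) ws → ¬ w ∈ map (s′ ∷_) ws
  apart ws s≢s′ p q = s≢s′ (just-injective (trans (sym (heads ws p)) (heads ws q)))

words-unique : ∀ k → Unique (words k)
words-unique zero    = [] ∷ []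
words-unique (suc k) =
  All.tabulate []∉ ∷
  Unique.++⁺ (Unique.map⁺ ∷-injʳ ih)
    (Unique.++⁺ (Unique.map⁺ ∷-injʳ ih) (Unique.map⁺ ∷-injʳ ih) n#d) e#nd
  where
  W  = words k
  ih = words-unique k
  E  = map (east ∷_) W
  N  = map (north ∷_) W
  D  = map (diagonal ∷_) W

  n#d : Disjoint N D
  n#d (p , q) = apart W (λ ()) p q

  e#nd : Disjoint E (N ++ D)
  e#nd (p , q) with ∈-++⁻ N q
  ... | inj₁ r = apart W (λ ()) p r
  ... | inj₂ r = apart W (λ ()) p r

  nothing≢just : ∀ {s : Step} → ¬ nothing ≡ just s
  nothing≢just ()

  []∉ : ∀ {w} → w ∈ E ++ N ++ D → ¬ [] ≡ w
  []∉ p refl with ∈-++⁻ E p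
  ... | inj₁ r = nothing≢just (heads W r)
  ... | inj₂ q with ∈-++⁻ N q
  ...   | inj₁ r = nothing≢just (heads W r)
  ...   | inj₂ r = nothing≢just (heads W r)

length≤end : ∀ w → length w ≤ proj₁ (end w) + proj₂ (end w)
length≤end []             = z≤n
length≤end (east ∷ w)     = s≤s (length≤end w)
length≤end (north ∷ w)    = begin
  suc (length w)                          ≤⟨ s≤s (length≤end w) ⟩
  suc (proj₁ (end w) + proj₂ (end w))     ≡⟨ sym (+-suc _ _) ⟩
  proj₁ (end w) + suc (proj₂ (end w))     ∎
  where open ≤-Reasoning
length≤end (diagonal ∷ w) = s≤s (begin
  length w                                ≤⟨ length≤end w ⟩
  proj₁ (end w) + proj₂ (end w)           ≤⟨ +-monoʳ-≤ (proj₁ (end w)) (n≤1+n _) ⟩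
  proj₁ (end w) + suc (proj₂ (end w))     ∎)
  where open ≤-Reasoning

𝕊-counts-paths : ∀ m → HasSize (SchröderPath m) (𝕊 m)
𝕊-counts-paths m =
  schröderPaths m ,
  Unique.filter⁺ (schröderPath? m) (words-unique (m + m)) ,
  (λ w → mk⇔ (proj₂ ∘ ∈-filter⁻ (schröderPath? m) {xs = words (m + m)})
             (λ p → ∈-filter⁺ (schröderPath? m) (words-complete _ w (bound w p)) p)) ,
  refl
  where
  bound : ∀ w → SchröderPath m w → length w ≤ m + m
  bound w (e , _) = begin
    length w                      ≤⟨ length≤end w ⟩
    proj₁ (end w) + proj₂ (end w) ≡⟨ cong₂ _+_ (cong proj₁ e) (cong proj₂ e) ⟩
    m + m                         ∎
    where open ≤-Reasoning

_ : map 𝕊 (0 ∷ 1 ∷ 2 ∷ 3 ∷ []) ≡ 1 ∷ 2 ∷ 6 ∷ 22 ∷ []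
_ = refl

{-# OPTIONS --safe #-}

-- A permutation avoids 3412 and 3421 when no ascent x … y is followed by two values below x. So
-- a prefix c has a completion iff at most one missing value lies below each element of V and none
-- below each element of U, and it may then be continued by y iff at most one missing value lies
-- below each entry of c that is less than y. Such a y lies in the first nonempty gap between used
-- values, or in the second one if the first contains a single value, and it splits its gap in
-- two. The number of completions therefore depends only on the gap sizes g₁, g₂, … ≥ 1, and
-- 𝕊 (g₁ - 1) 𝕊 g₂ 𝕊 g₃ ⋯ satisfies the resulting recurrence because of
-- 𝕊 (m + 1) = 𝕊 m + Σ 𝕊 i 𝕊 (m - i), the first-return decomposition of Schröder paths.

module Submission where

open import Defs
open import Data.Bool.Base using (Bool; true; false)
open import Data.Empty using (⊥-elim)
open import Data.Fin.Base as Fin using (Fin)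
open import Data.Fin.Patterns using (0F; 1F; 2F; 3F)
open import Data.Nat.Properties
open import Data.List.Base
  using (List; []; _∷_; [_]; _++_; applyUpTo; drop; filter; head; inits; length; lookup; map;
         tabulate; take)
open import Data.List.Properties
open import Data.List.Membership.Propositional using (_∈_; _∉_)
open import Data.List.Membership.Propositional.Properties
import Data.List.Membership.DecPropositional as DecMembership
open import Data.List.Membership.Propositional.Properties.WithK using (unique∧set⇒bag)
open import Data.List.Relation.Binary.BagAndSetEquality using (∼bag⇒↭)
open import Data.List.Relation.Binary.Permutation.Propositional using (_↭_; ↭-sym; ↭-trans; ↭⇒↭ₛ)
open import Data.List.Relation.Binary.Permutation.Propositional.Properties using (↭-length; ∈-resp-↭)
import Data.List.Relation.Binary.Permutation.Setoid.Properties as PermS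
open import Data.List.Relation.Binary.Sublist.Propositional
  using (_⊆_; []; _∷_; _∷ʳ_; minimum; from∈; to∈)
open import Data.List.Relation.Binary.Sublist.Propositional.Properties as Sub using ()
open import Data.List.Relation.Unary.All as All using (All; []; _∷_)
import Data.List.Relation.Unary.All.Properties as All
open import Data.List.Relation.Unary.AllPairs as AllPairs using (AllPairs; []; _∷_)
open import Data.List.Relation.Unary.Any using (here; there)
open import Data.List.Relation.Unary.Unique.Propositional using (Unique)
import Data.List.Relation.Unary.Unique.Propositional.Properties as Unique
open import Data.List.Relation.Unary.Sorted.TotalOrder.Properties using (AllPairs⇒Sorted; ↗↭↗⇒≋)
open import Data.List.Relation.Binary.Pointwise using (Pointwise-≡⇒≡)
open import Data.List.Sort ≤-decTotalOrder using (sort; sort-↭; sort-↗)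
open import Data.Maybe.Base using (fromMaybe)
open import Data.Nat.ListAction using (sum; product)
open import Data.Nat.Base
open import Data.Product.Base using (∃; ∃₂; _×_; _,_; proj₁; proj₂)
open import Data.Sum.Base using (_⊎_; inj₁; inj₂)
open import Function.Base using (_∘_; case_of_)
open import Function.Bundles using (_⇔_; mk⇔; Equivalence)
open import Level using (0ℓ)
open import Relation.Binary.Definitions using (tri<; tri≈; tri>)
open import Relation.Binary.PropositionalEquality hiding ([_])
open import Relation.Nullary.Decidable using (yes; no; does; does-⇔; dec-true; dec-false)
open import Relation.Nullary.Negation using (¬_; contradiction)
open import Relation.Unary using (Pred)

open Equivalence using (to; from)

-- Counting by enumeration

private
  variable
    A B : Set
    X Y : Pred A 0ℓ
    M N : ℕ

HasSize-⇔ : (∀ x → X x ⇔ Y x) → HasSize X N → HasSize Y N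
HasSize-⇔ X⇔Y (xs , xs! , ∈xs , eq) =
  xs , xs! , (λ x → mk⇔ (to (X⇔Y x) ∘ to (∈xs x)) (from (∈xs x) ∘ from (X⇔Y x))) , eq

-- Duplicate-free lists with the same members are permutations of each other. Numerical identities
-- can thus be proved by counting one set in two ways.
HasSize-unique : HasSize X M → HasSize X N → M ≡ N
HasSize-unique (xs , xs! , ∈xs , refl) (ys , ys! , ∈ys , refl) =
  ↭-length (∼bag⇒↭ (unique∧set⇒bag xs! ys! (λ {x} →
    mk⇔ (from (∈ys x) ∘ to (∈xs x)) (from (∈xs x) ∘ to (∈ys x)))))

HasSize-∅ : (∀ x → ¬ X x) → HasSize X 0
HasSize-∅ ¬X = [] , [] , (λ x → mk⇔ (λ ()) (⊥-elim ∘ ¬X x)) , refl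

HasSize-⊎ : (∀ x → X x → ¬ Y x) → HasSize X M → HasSize Y N →
            HasSize (λ x → X x ⊎ Y x) (M + N)
HasSize-⊎ X#Y (xs , xs! , ∈xs , refl) (ys , ys! , ∈ys , refl) =
  xs ++ ys ,
  Unique.++⁺ xs! ys! (λ {x} (p , q) → X#Y x (to (∈xs x) p) (to (∈ys x) q)) ,
  (λ x → mk⇔ (λ p → case ∈-++⁻ xs p of λ where
                (inj₁ q) → inj₁ (to (∈xs x) q)
                (inj₂ q) → inj₂ (to (∈ys x) q))
             (λ where
                (inj₁ q) → ∈-++⁺ˡ (from (∈xs x) q)
                (inj₂ q) → ∈-++⁺ʳ xs (from (∈ys x) q))) ,
  length-++ xs

HasSize-image : (f : A → B) → (∀ {x y} → f x ≡ f y → x ≡ y) → HasSize X N →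
                HasSize (λ y → ∃ λ x → X x × y ≡ f x) N
HasSize-image f inj (xs , xs! , ∈xs , refl) =
  map f xs , Unique.map⁺ inj xs! ,
  (λ y → mk⇔ (λ p → let x , x∈ , eq = ∈-map⁻ f p in x , to (∈xs x) x∈ , eq)
             (λ (x , Xx , eq) → subst (_∈ map f xs) (sym eq) (∈-map⁺ f (from (∈xs x) Xx)))) ,
  length-map f xs

HasSize-⋃ : {Z : A → Pred B 0ℓ} → HasSize X M → (∀ x → X x → HasSize (Z x) N) →
            (∀ {x x′ y} → X x → X x′ → Z x y → Z x′ y → x ≡ x′) →
            HasSize (λ y → ∃ λ x → X x × Z x y) (M * N)
HasSize-⋃ {A = A} {X = X} {N = N} {Z = Z} (xs , xs! , ∈xs , refl) size disj =
  HasSize-⇔ (λ y → mk⇔ (λ (x , x∈ , z) → x , to (∈xs x) x∈ , z)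
                       (λ (x , Xx , z) → x , from (∈xs x) Xx , z))
    (over xs xs! (λ {x} → to (∈xs x)))
  where
  over : (ys : List A) → Unique ys → (∀ {x} → x ∈ ys → X x) →
         HasSize (λ y → ∃ λ x → x ∈ ys × Z x y) (length ys * N)
  over []       _            _  = HasSize-∅ λ _ ()
  over (x ∷ ys) (x∉ ∷ ys!) ⊆X =
    HasSize-⇔
      (λ y → mk⇔ (λ where
                    (inj₁ z)             → x , here refl , z
                    (inj₂ (x′ , x∈ , z)) → x′ , there x∈ , z)
                 (λ where
                    (x′ , here refl , z) → inj₁ z
                    (x′ , there x∈ , z)  → inj₂ (x′ , x∈ , z)))
      (HasSize-⊎ (λ y z (x′ , x∈ , z′) →
                    All.lookup x∉ x∈ (disj (⊆X (here refl)) (⊆X (there x∈)) z z′))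
        (size x (⊆X (here refl))) (over ys ys! (⊆X ∘ there)))

-- Schröder paths

-- Dyck h w: the path w, begun h units below the line y = x, stays weakly below the line and
-- ends on it.
data Dyck : ℕ → List Step → Set where
  []       : Dyck 0 []
  east     : ∀ {h w} → Dyck (suc h) w → Dyck h (east ∷ w)
  north    : ∀ {h w} → Dyck h w → Dyck (suc h) (north ∷ w)
  diagonal : ∀ {h w} → Dyck h w → Dyck h (diagonal ∷ w)

width height : List Step → ℕ
width  = proj₁ ∘ end
height = proj₂ ∘ end

-- The starting depth `h` is general so that induction can strip the first step. A north step at
-- depth 0 is refuted by the initial segment consisting of that step alone.
valid⇒Dyck : ∀ h w → All (λ v → height v ≤ h + width v) (inits w) →
             height w ≡ h + width w → Dyck h w
valid⇒Dyck h [] _ eq rewrite trans (sym (+-identityʳ h)) (sym eq) = []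
valid⇒Dyck h (east ∷ w) (_ ∷ below) eq =
  east (valid⇒Dyck (suc h) w
    (All.map (λ {v} → subst (height v ≤_) (+-suc h (width v))) (All.map⁻ below))
    (trans eq (+-suc h (width w))))
valid⇒Dyck zero (north ∷ w) (_ ∷ () ∷ _) eq
valid⇒Dyck (suc h) (north ∷ w) (_ ∷ below) eq =
  north (valid⇒Dyck h w (All.map s≤s⁻¹ (All.map⁻ below)) (suc-injective eq))
valid⇒Dyck h (diagonal ∷ w) (_ ∷ below) eq =
  diagonal (valid⇒Dyck h w
    (All.map (λ {v} → s≤s⁻¹ ∘ subst (suc (height v) ≤_) (+-suc h (width v))) (All.map⁻ below))
    (suc-injective (trans eq (+-suc h (width w)))))

Dyck⇒height : ∀ {h w} → Dyck h w → height w ≡ h + width w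
Dyck⇒height [] = refl
Dyck⇒height {h} {_ ∷ w} (east d) = trans (Dyck⇒height d) (sym (+-suc h (width w)))
Dyck⇒height (north d) = cong suc (Dyck⇒height d)
Dyck⇒height {h} {_ ∷ w} (diagonal d) =
  trans (cong suc (Dyck⇒height d)) (sym (+-suc h (width w)))

Dyck⇒below : ∀ {h w} → Dyck h w → All (λ v → height v ≤ h + width v) (inits w)
Dyck⇒below [] = z≤n ∷ []
Dyck⇒below {h} (east d) =
  z≤n ∷ All.map⁺ (All.map (λ {v} → subst (height v ≤_) (sym (+-suc h (width v))))
                          (Dyck⇒below d))
Dyck⇒below (north d) = z≤n ∷ All.map⁺ (All.map s≤s (Dyck⇒below d))
Dyck⇒below {h} (diagonal d) =
  z≤n ∷ All.map⁺ (All.map (λ {v} → subst (suc (height v) ≤_) (sym (+-suc h (width v))) ∘ s≤s)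
                          (Dyck⇒below d))

-- The height alone fixes the endpoint, since height and width agree on a path that starts and ends
-- on the line.
DyckPath : ℕ → Pred (List Step) 0ℓ
DyckPath m w = Dyck 0 w × height w ≡ m

SchröderPath⇔DyckPath : ∀ m w → SchröderPath m w ⇔ DyckPath m w
SchröderPath⇔DyckPath m w = mk⇔
  (λ (eq , below) →
     valid⇒Dyck 0 w below (trans (cong proj₂ eq) (sym (cong proj₁ eq))) , cong proj₂ eq)
  (λ (d , eq) → cong₂ _,_ (trans (sym (Dyck⇒height d)) eq) eq , Dyck⇒below d)

𝕊-counts-Dyck : ∀ m → HasSize (DyckPath m) (𝕊 m)
𝕊-counts-Dyck m = HasSize-⇔ (SchröderPath⇔DyckPath m) (𝕊-counts-paths m)

glue : List Step → List Step → List Step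
glue u v = u ++ north ∷ v

glue-Dyck : ∀ {h k u v} → Dyck k u → Dyck h v → Dyck (k + suc h) (glue u v)
glue-Dyck []           e = north e
glue-Dyck (east d)     e = east (glue-Dyck d e)
glue-Dyck (north d)    e = north (glue-Dyck d e)
glue-Dyck (diagonal d) e = diagonal (glue-Dyck d e)

-- The cut is made at the first north step that reaches depth `h`; until then the path stays at
-- depth at least `suc h`. The equation on `j` is separate so that `Dyck` is matched at a variable
-- index.
unglue : ∀ {j h w} k → j ≡ k + suc h → Dyck j w →
         ∃₂ λ u v → Dyck k u × Dyck h v × w ≡ glue u v
unglue zero    () []
unglue (suc k) () []
unglue k eq (east d) with u , v , du , dv , refl ← unglue (suc k) (cong suc eq) d =
  east ∷ u , v , east du , dv , refl
unglue zero refl (north d) = [] , _ , [] , d , refl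
unglue (suc k) eq (north d) with u , v , du , dv , refl ← unglue k (suc-injective eq) d =
  north ∷ u , v , north du , dv , refl
unglue k eq (diagonal d) with u , v , du , dv , refl ← unglue k eq d =
  diagonal ∷ u , v , diagonal du , dv , refl

-- The separating north step is the first to cross the level on which `u` ends, so the glued word
-- determines where `u` stops.
glue-injectiveˡ : ∀ {k u u′ v v′} → Dyck k u → Dyck k u′ → glue u v ≡ glue u′ v′ → u ≡ u′
glue-injectiveˡ []           []            _  = refl
glue-injectiveˡ (east d)     (east d′)     eq =
  cong (east ∷_) (glue-injectiveˡ d d′ (∷-injectiveʳ eq))
glue-injectiveˡ (north d)    (north d′)    eq =
  cong (north ∷_) (glue-injectiveˡ d d′ (∷-injectiveʳ eq))
glue-injectiveˡ (diagonal d) (diagonal d′) eq =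
  cong (diagonal ∷_) (glue-injectiveˡ d d′ (∷-injectiveʳ eq))

height-glue : ∀ u v → height (glue u v) ≡ suc (height u + height v)
height-glue []             v = refl
height-glue (east ∷ u)     v = height-glue u v
height-glue (north ∷ u)    v = cong suc (height-glue u v)
height-glue (diagonal ∷ u) v = cong suc (height-glue u v)

-- The sum of `𝕊 (i + j) * g (k - j)` over 0 ≤ j ≤ k; at `i = 0` it is the convolution of `𝕊` with
-- `g`.
conv : (ℕ → ℕ) → ℕ → ℕ → ℕ
conv g i zero    = 𝕊 i * g 0
conv g i (suc k) = 𝕊 i * g (suc k) + conv g (suc i) k

-- Paths that begin with an east step, cut at their first return: `u` is the part enclosed before it
-- and `v` the part after it.
Returning : (ℕ → ℕ → Set) → Pred (List Step) 0ℓ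
Returning R w = ∃₂ λ u v →
  w ≡ east ∷ glue u v × Dyck 0 u × Dyck 0 v × R (height u) (height v)

Returning-exact : ∀ i k → HasSize (Returning (λ a b → a ≡ i × b ≡ k)) (𝕊 i * 𝕊 k)
Returning-exact i k =
  HasSize-⇔ (λ w → mk⇔ (λ (u , (du , p) , v , (dv , q) , eq) → u , v , eq , du , dv , p , q)
                       (λ (u , v , eq , du , dv , p , q) → u , (du , p) , v , (dv , q) , eq))
    (HasSize-⋃ (𝕊-counts-Dyck i)
      (λ u _ → HasSize-image (λ v → east ∷ glue u v)
                 (∷-injectiveʳ ∘ ++-cancelˡ u _ _ ∘ ∷-injectiveʳ) (𝕊-counts-Dyck k))
      (λ (du , _) (du′ , _) (_ , _ , eq) (_ , _ , eq′) →
         glue-injectiveˡ du du′ (∷-injectiveʳ (trans (sym eq) eq′))))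

-- The bound `i ≤ a` follows the recursion of `conv`: paths with `a = i` give its first summand,
-- those with `i < a` the others.
Returning-from : ∀ i k → HasSize (Returning (λ a b → i ≤ a × a + b ≡ i + k)) (conv 𝕊 i k)
Returning-from i zero = HasSize-⇔
  (λ w → mk⇔ (λ where (u , v , eq , du , dv , refl , q) →
                        u , v , eq , du , dv , ≤-refl , cong (i +_) q)
             (λ (u , v , eq , du , dv , i≤ , q) →
                let p = ≤-antisym (≤-trans (m≤m+n _ _) (≤-reflexive (trans q (+-identityʳ i)))) i≤
                in u , v , eq , du , dv , p ,
                   +-cancelˡ-≡ i _ _ (trans (cong (_+ height v) (sym p)) q)))
  (Returning-exact i 0)
Returning-from i (suc k) = HasSize-⇔
  (λ w → mk⇔ (λ where
                (inj₁ (u , v , eq , du , dv , refl , q)) →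
                  u , v , eq , du , dv , ≤-refl , cong (i +_) q
                (inj₂ (u , v , eq , du , dv , i≤ , q)) →
                  u , v , eq , du , dv , <⇒≤ i≤ , trans q (sym (+-suc i k)))
             (λ (u , v , eq , du , dv , i≤ , q) → case m≤n⇒m<n∨m≡n i≤ of λ where
                (inj₁ i<) → inj₂ (u , v , eq , du , dv , i< , trans q (+-suc i k))
                (inj₂ p)  → inj₁ (u , v , eq , du , dv , sym p ,
                  +-cancelˡ-≡ i _ _ (trans (cong (_+ height v) p) q))))
  (HasSize-⊎
    (λ where
      _ (u , _ , eq , du , _ , refl , _) (u′ , _ , eq′ , du′ , _ , i< , _) →
        <⇒≢ i< (cong height (glue-injectiveˡ du du′ (∷-injectiveʳ (trans (sym eq) eq′)))))
    (Returning-exact i (suc k)) (Returning-from (suc i) k))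

-- A nonempty Schröder path either begins with a diagonal step or is decomposed at its first
-- return to the line y = x.
𝕊-suc : ∀ m → 𝕊 (suc m) ≡ 𝕊 m + conv 𝕊 0 m
𝕊-suc m = HasSize-unique (𝕊-counts-Dyck (suc m))
  (HasSize-⇔ (λ w → mk⇔ join split)
    (HasSize-⊎ (λ where _ (_ , _ , refl) (_ , _ , () , _))
      (HasSize-image (diagonal ∷_) ∷-injectiveʳ (𝕊-counts-Dyck m))
      (Returning-from 0 m)))
  where
  join : ∀ {w} → (∃ λ v → DyckPath m v × w ≡ diagonal ∷ v)
               ⊎ Returning (λ a b → 0 ≤ a × a + b ≡ m) w → DyckPath (suc m) w
  join (inj₁ (v , (d , eq) , refl)) = diagonal d , cong suc eq
  join (inj₂ (u , v , refl , du , dv , _ , q)) =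
    east (glue-Dyck du dv) , trans (height-glue u v) (cong suc q)

  split : ∀ {w} → DyckPath (suc m) w → (∃ λ v → DyckPath m v × w ≡ diagonal ∷ v)
                                      ⊎ Returning (λ a b → 0 ≤ a × a + b ≡ m) w
  split (east d , eq) with u , v , du , dv , refl ← unglue 0 refl d =
    inj₂ (u , v , refl , du , dv , z≤n , suc-injective (trans (sym (height-glue u v)) eq))
  split (diagonal d , eq) = inj₁ (_ , (d , suc-injective eq) , refl)

-- Weights

-- A list of booleans records, in increasing order of the values, which values have been used.
-- completions is the claimed number of ways to place the unused ones; completionsAfter k is
-- this number when k + 1 unused values precede the list.
completionsAfter : ℕ → List Bool → ℕ
completionsAfter k []          = 𝕊 k
completionsAfter k (true ∷ b)  = 𝕊 k * completionsAfter 0 b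
completionsAfter k (false ∷ b) = completionsAfter (suc k) b

completions : List Bool → ℕ
completions []          = 1
completions (true ∷ b)  = completions b
completions (false ∷ b) = completionsAfter 0 b

-- The number of completions when the list is preceded by values of which p unused ones lie below
-- some used one and q unused ones lie above all used ones; this is meaningful for p ≤ 1.
completionsWith : ℕ → ℕ → List Bool → ℕ
completionsWith zero    zero    b = completions b
completionsWith zero    (suc q) b = completionsAfter q b
completionsWith (suc p) q       b = completionsAfter q b

-- The value to be placed next may be any unused value that exceeds no used value having two
-- unused values below it.
nextCompletions : ℕ → ℕ → List Bool → ℕ
nextCompletions p q []          = 0
nextCompletions p q (true ∷ b)  = nextCompletions (p + q) 0 b
nextCompletions p q (false ∷ b) with p ≤? 1
... | yes _ = completionsWith p q (true ∷ b) + nextCompletions p (suc q) b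
... | no  _ = nextCompletions p (suc q) b

nextCompletions-blocked : ∀ p q b → 2 ≤ p → nextCompletions p q b ≡ 0
nextCompletions-blocked p q []          2≤p = refl
nextCompletions-blocked p q (true ∷ b)  2≤p =
  nextCompletions-blocked (p + q) 0 b (≤-trans 2≤p (m≤m+n p q))
nextCompletions-blocked p q (false ∷ b) 2≤p with p ≤? 1
... | yes p≤1 = contradiction p≤1 (<⇒≱ 2≤p)
... | no  _   = nextCompletions-blocked p (suc q) b 2≤p

nextCompletions-shift : ∀ q b → nextCompletions 0 (suc q) b ≡ nextCompletions 1 q b
nextCompletions-shift q []          = refl
nextCompletions-shift q (true ∷ b)  = refl
nextCompletions-shift q (false ∷ b) =
  cong (𝕊 q * completionsAfter 0 b +_) (nextCompletions-shift (suc q) b)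

conv-∷ʳ : ∀ g i k → conv g i (suc k) ≡ conv (g ∘ suc) i k + 𝕊 (suc (i + k)) * g 0
conv-∷ʳ g i zero rewrite +-identityʳ i = refl
conv-∷ʳ g i (suc k) rewrite conv-∷ʳ g (suc i) k | +-suc i k = sym (+-assoc (𝕊 i * _) _ _)

conv-*ʳ : ∀ g r i k → conv (λ j → g j * r) i k ≡ conv g i k * r
conv-*ʳ g r i zero    = sym (*-assoc (𝕊 i) (g 0) r)
conv-*ʳ g r i (suc k) = trans
  (cong₂ _+_ (sym (*-assoc (𝕊 i) (g (suc k)) r)) (conv-*ʳ g r (suc i) k))
  (sym (*-distribʳ-+ r (𝕊 i * g (suc k)) (conv g (suc i) k)))

completionsAfter-suc : ∀ q b →
  completionsAfter q b + conv (λ k → completionsAfter k b) 0 q + nextCompletions 1 (suc q) b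
    ≡ completionsAfter (suc q) b
completionsAfter-suc q [] = trans (+-identityʳ _) (sym (𝕊-suc q))
completionsAfter-suc q (true ∷ b) = begin
  𝕊 q * r + conv (λ k → 𝕊 k * r) 0 q + nextCompletions (2 + q) 0 b
    ≡⟨ cong₂ (λ x y → 𝕊 q * r + x + y) (conv-*ʳ 𝕊 r 0 q)
             (nextCompletions-blocked (2 + q) 0 b (s≤s (s≤s z≤n))) ⟩
  𝕊 q * r + conv 𝕊 0 q * r + 0 ≡⟨ +-identityʳ _ ⟩
  𝕊 q * r + conv 𝕊 0 q * r     ≡⟨ *-distribʳ-+ r (𝕊 q) (conv 𝕊 0 q) ⟨
  (𝕊 q + conv 𝕊 0 q) * r       ≡⟨ cong (_* r) (𝕊-suc q) ⟨
  𝕊 (suc q) * r                ∎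
  where
  open ≡-Reasoning
  r = completionsAfter 0 b
completionsAfter-suc q (false ∷ b) = begin
  g (suc q) + conv (g ∘ suc) 0 q + (𝕊 (suc q) * g 0 + nextCompletions 1 (2 + q) b)
    ≡⟨ +-assoc (g (suc q) + conv (g ∘ suc) 0 q) _ _ ⟨
  g (suc q) + conv (g ∘ suc) 0 q + 𝕊 (suc q) * g 0 + nextCompletions 1 (2 + q) b
    ≡⟨ cong (_+ nextCompletions 1 (2 + q) b)
            (trans (+-assoc (g (suc q)) _ _) (cong (g (suc q) +_) (sym (conv-∷ʳ g 0 q)))) ⟩
  g (suc q) + conv g 0 (suc q) + nextCompletions 1 (2 + q) b
    ≡⟨ completionsAfter-suc (suc q) b ⟩
  g (suc (suc q)) ∎
  where
  open ≡-Reasoning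
  g = λ k → completionsAfter k b

completionsAfter-zero : ∀ b → completions b + nextCompletions 1 0 b ≡ completionsAfter 0 b
completionsAfter-zero []          = refl
completionsAfter-zero (true ∷ b)  =
  trans (completionsAfter-zero b) (sym (*-identityˡ (completionsAfter 0 b)))
completionsAfter-zero (false ∷ b) =
  trans (sym (+-assoc (completionsAfter 0 b) _ _)) (completionsAfter-suc 0 b)

completions-step : ∀ b → false ∈ b → nextCompletions 0 0 b ≡ completions b
completions-step (true ∷ b)  (there p) = completions-step b p
completions-step (false ∷ b) _         =
  trans (cong (completions b +_) (nextCompletions-shift 0 b)) (completionsAfter-zero b)

-- Patterns as sublists

-- Turns occurrences given by positions into sublists, which are easier to append and cut. The head
-- of `τ` is kept if the first position is 0 and dropped otherwise; the positions still to be used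
-- are lowered by one.
increasing⇒⊆ : ∀ {k} (τ : List A) (ι : Fin k → Fin (length τ)) →
               (∀ {a b} → a Fin.< b → ι a Fin.< ι b) → tabulate (lookup τ ∘ ι) ⊆ τ
increasing⇒⊆ {k = zero} τ ι mono = minimum τ
increasing⇒⊆ {k = suc k} [] ι mono with () ← ι Fin.zero
increasing⇒⊆ {A = A} {k = suc k} (x ∷ τ) ι mono with ι Fin.zero in eq
... | Fin.zero = refl ∷ shift (ι ∘ Fin.suc) (mono ∘ s≤s)
                   (λ a → subst (Fin._< ι (Fin.suc a)) eq (mono z<s))
  where
  shift : ∀ {l} (κ : Fin l → Fin (suc (length τ))) → (∀ {a b} → a Fin.< b → κ a Fin.< κ b) →
          (∀ a → Fin.zero {length τ} Fin.< κ a) → tabulate (lookup (x ∷ τ) ∘ κ) ⊆ τ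
  shift κ κ-mono pos = subst (_⊆ τ) 
    (tabulate-cong (λ a → cong (lookup (x ∷ τ)) (sym (pred-κ a .proj₂))))
    (increasing⇒⊆ τ (proj₁ ∘ pred-κ) (λ {a} {b} a<b →
      s≤s⁻¹ (subst₂ Fin._<_ (pred-κ a .proj₂) (pred-κ b .proj₂) (κ-mono a<b))))
    where
    pred-κ : ∀ a → ∃ λ i → κ a ≡ Fin.suc i
    pred-κ a with κ a | pos a
    ... | Fin.suc i | _ = i , refl
... | Fin.suc i = x ∷ʳ subst (_⊆ τ)
                    (cong₂ _∷_ refl (tabulate-cong (λ a →
                       cong (lookup (x ∷ τ)) (sym (pred-ι a .proj₂)))))
                    (increasing⇒⊆ τ κ κ-mono)
  where
  pred-ι : ∀ a → ∃ λ j → ι (Fin.suc a) ≡ Fin.suc j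
  pred-ι a with ι (Fin.suc a) | mono {Fin.zero} {Fin.suc a} z<s
  ... | Fin.suc j | _ = j , refl
  ... | Fin.zero  | p with () ← subst (Fin._< Fin.zero {length τ}) eq p

  κ : Fin (suc k) → Fin (length τ)
  κ Fin.zero    = i
  κ (Fin.suc a) = pred-ι a .proj₁

  suc-κ : ∀ a → ι a ≡ Fin.suc (κ a)
  suc-κ Fin.zero    = eq
  suc-κ (Fin.suc a) = pred-ι a .proj₂

  κ-mono : ∀ {a b} → a Fin.< b → κ a Fin.< κ b
  κ-mono {a} {b} a<b = s≤s⁻¹ (subst₂ Fin._<_ (suc-κ a) (suc-κ b) (mono a<b))

position : {xs ys : List A} → xs ⊆ ys → Fin (length xs) → Fin (length ys)
position (y ∷ʳ p) i           = Fin.suc (position p i)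
position (_ ∷ p)  Fin.zero    = Fin.zero
position (_ ∷ p)  (Fin.suc i) = Fin.suc (position p i)

position-mono : {xs ys : List A} (p : xs ⊆ ys) →
                ∀ {a b} → a Fin.< b → position p a Fin.< position p b
position-mono (y ∷ʳ p) a<b = s≤s (position-mono p a<b)
position-mono (_ ∷ p) {Fin.zero}  {Fin.suc b} _   = z<s
position-mono (_ ∷ p) {Fin.suc a} {Fin.suc b} a<b = s≤s (position-mono p (s≤s⁻¹ a<b))

lookup-position : {xs ys : List A} (p : xs ⊆ ys) → ∀ i → lookup ys (position p i) ≡ lookup xs i
lookup-position (y ∷ʳ p)   i           = lookup-position p i
lookup-position (refl ∷ p) Fin.zero    = refl
lookup-position (refl ∷ p) (Fin.suc i) = lookup-position p i

SameOrder : ∀ {k} → (Fin k → ℕ) → (Fin k → ℕ) → Set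
SameOrder f g = ∀ {a b} → a Fin.< b → f a < f b ⇔ g a < g b

-- Lets a pattern be verified row by row: the first entry against all later ones, then the remaining
-- entries.
SameOrder-suc : ∀ {k} {f g : Fin (suc k) → ℕ} →
                (∀ b → f Fin.zero < f (Fin.suc b) ⇔ g Fin.zero < g (Fin.suc b)) →
                SameOrder (f ∘ Fin.suc) (g ∘ Fin.suc) → SameOrder f g
SameOrder-suc h t {Fin.zero}  {Fin.suc b} _   = h b
SameOrder-suc h t {Fin.suc a} {Fin.suc b} a<b = t (s≤s⁻¹ a<b)

⊆⇒occurrence : ∀ {xs τ} (p : xs ⊆ τ) {σ : Fin (length xs) → ℕ} → SameOrder (lookup xs) σ →
               ∀ {a b} → a Fin.< b → (position p a Fin.< position p b) ×
                 (lookup τ (position p a) < lookup τ (position p b) ⇔ σ a < σ b)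
⊆⇒occurrence p same {a} {b} a<b rewrite lookup-position p a | lookup-position p b =
  position-mono p a<b , same a<b

both : {P Q : Set} → P → Q → P ⇔ Q
both p q = mk⇔ (λ _ → q) (λ _ → p)

neither : {P Q : Set} → ¬ P → ¬ Q → P ⇔ Q
neither ¬p ¬q = mk⇔ (⊥-elim ∘ ¬p) (⊥-elim ∘ ¬q)

⊆-Unique : {xs ys : List A} → xs ⊆ ys → Unique ys → Unique xs
⊆-Unique []         _          = []
⊆-Unique (y ∷ʳ p)   (_ ∷ ys!)  = ⊆-Unique p ys!
⊆-Unique (refl ∷ p) (y∉ ∷ ys!) = Sub.All-resp-⊆ p y∉ ∷ ⊆-Unique p ys!

Ascents Threats : List ℕ → Pred ℕ 0ℓ
Ascents τ x = ∃ λ y → (x ∷ y ∷ []) ⊆ τ × x < y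
Threats τ x = ∃₂ λ y u → (x ∷ y ∷ u ∷ []) ⊆ τ × x < y × u < x

-- Both forbidden patterns at once: for distinct entries, `u < v` makes a 3412 pattern and `v < u` a
-- 3421 pattern.
Bad : List ℕ → Set
Bad τ = ∃₂ λ x y → ∃₂ λ u v → (x ∷ y ∷ u ∷ v ∷ []) ⊆ τ × x < y × u < x × v < x

V⇔Ascents : ∀ c x → V c x ⇔ Ascents c x
V⇔Ascents c x = mk⇔ ⇒ ⇐
  where
  ⇒ : V c x → Ascents c x
  ⇒ (i , j , i<j , ci<cj , refl) = lookup c j , increasing⇒⊆ c ι mono , ci<cj
    where
    ι : Fin 2 → Fin (length c)
    ι 0F = i
    ι 1F = j

    mono : ∀ {a b} → a Fin.< b → ι a Fin.< ι b
    mono {0F} {1F} _ = i<j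
    mono {1F} {1F} (s≤s ())

  ⇐ : Ascents c x → V c x
  ⇐ (y , p , x<y) = position p 0F , position p 1F , position-mono p {0F} {1F} z<s ,
    subst₂ _<_ (sym (lookup-position p 0F)) (sym (lookup-position p 1F)) x<y , lookup-position p 0F

U⇔Threats : ∀ c x → Unique c → U c x ⇔ Threats c x
U⇔Threats c x c! = mk⇔ ⇒ ⇐
  where
  ⇒ : U c x → Threats c x
  ⇒ (ι , occ , refl)
    with p ← increasing⇒⊆ c ι (proj₁ ∘ occ) with (_ ∷ x≢u ∷ []) ∷ _ ← ⊆-Unique p c! =
    _ , _ , p ,
    from (occ {0F} {1F} z<s .proj₂) ≤-refl ,
    -- The occurrence only denies `x < u`; distinctness of the entries gives `u < x`.
    ≤∧≢⇒< (≮⇒≥ λ lt → case to (occ {0F} {2F} z<s .proj₂) lt of λ { (s≤s ()) }) (x≢u ∘ sym)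

  ⇐ : Threats c x → U c x
  ⇐ (y , u , p , x<y , u<x) =
    position p , ⊆⇒occurrence p {σ = lookup 231-pattern}
      (SameOrder-suc {2} (λ where
          0F → both x<y ≤-refl
          1F → neither (<-asym u<x) λ { (s≤s ()) })
      (SameOrder-suc {1} (λ where 0F → neither (<-asym (<-trans u<x x<y)) λ { (s≤s ()) })
      (SameOrder-suc {0} (λ ()) λ { {()} }))) ,
    lookup-position p 0F

avoids⇔¬Bad : ∀ τ → Unique τ → All (τ Avoids_) (3412-pattern ∷ 3421-pattern ∷ []) ⇔ (¬ Bad τ)
avoids⇔¬Bad τ τ! = mk⇔ ⇒ ⇐
  where
  ⇒ : All (τ Avoids_) (3412-pattern ∷ 3421-pattern ∷ []) → ¬ Bad τ
  ⇒ (¬3412 ∷ ¬3421 ∷ []) (x , y , u , v , p , x<y , u<x , v<x)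
    with _ ∷ _ ∷ (u≢v ∷ []) ∷ _ ← ⊆-Unique p τ! | <-cmp u v
  ... | tri< u<v _ _ = ¬3412 (position p , ⊆⇒occurrence p {σ = lookup 3412-pattern}
      (SameOrder-suc {3} (λ where
          0F → both x<y ≤-refl
          1F → neither (<-asym u<x) λ { (s≤s ()) }
          2F → neither (<-asym v<x) λ { (s≤s (s≤s ())) })
      (SameOrder-suc {2} (λ where
          0F → neither (<-asym (<-trans u<x x<y)) λ { (s≤s ()) }
          1F → neither (<-asym (<-trans v<x x<y)) λ { (s≤s (s≤s ())) })
      (SameOrder-suc {1} (λ where 0F → both u<v ≤-refl)
      (SameOrder-suc {0} (λ ()) λ { {()} })))))
  ... | tri≈ _ u≡v _ = u≢v u≡v
  ... | tri> u≮v _ v<u = ¬3421 (position p , ⊆⇒occurrence p {σ = lookup 3421-pattern}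
      (SameOrder-suc {3} (λ where
          0F → both x<y ≤-refl
          1F → neither (<-asym u<x) λ { (s≤s (s≤s ())) }
          2F → neither (<-asym v<x) λ { (s≤s ()) })
      (SameOrder-suc {2} (λ where
          0F → neither (<-asym (<-trans u<x x<y)) λ { (s≤s (s≤s ())) }
          1F → neither (<-asym (<-trans v<x x<y)) λ { (s≤s ()) })
      (SameOrder-suc {1} (λ where 0F → neither u≮v λ { (s≤s ()) })
      (SameOrder-suc {0} (λ ()) λ { {()} })))))

  ⇐ : ¬ Bad τ → All (τ Avoids_) (3412-pattern ∷ 3421-pattern ∷ [])
  ⇐ ¬bad = (λ (ι , occ) → ¬bad (bad ι (proj₁ ∘ occ) (from (occ {0F} {1F} z<s .proj₂) ≤-refl)
                (λ lt → case to (occ {0F} {2F} z<s .proj₂) lt of λ { (s≤s ()) })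
                (λ lt → case to (occ {0F} {3F} z<s .proj₂) lt of λ { (s≤s (s≤s ())) })))
         ∷ (λ (ι , occ) → ¬bad (bad ι (proj₁ ∘ occ) (from (occ {0F} {1F} z<s .proj₂) ≤-refl)
                (λ lt → case to (occ {0F} {2F} z<s .proj₂) lt of λ { (s≤s (s≤s ())) })
                (λ lt → case to (occ {0F} {3F} z<s .proj₂) lt of λ { (s≤s ()) })))
         ∷ []
    where
    bad : (ι : Fin 4 → Fin (length τ)) → (∀ {a b} → a Fin.< b → ι a Fin.< ι b) →
          lookup τ (ι 0F) < lookup τ (ι 1F) →
          ¬ lookup τ (ι 0F) < lookup τ (ι 2F) → ¬ lookup τ (ι 0F) < lookup τ (ι 3F) → Bad τ
    bad ι mono x<y x≮u x≮v
      with p ← increasing⇒⊆ τ ι mono with (_ ∷ x≢u ∷ x≢v ∷ []) ∷ _ ← ⊆-Unique p τ! =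
      _ , _ , _ , _ , p , x<y , ≤∧≢⇒< (≮⇒≥ x≮u) (x≢u ∘ sym) , ≤∧≢⇒< (≮⇒≥ x≮v) (x≢v ∘ sym)

-- Missing values

open DecMembership _≟_ using (_∈?_; _∉?_)

∈-[1⋯]⁺ : ∀ {x n} → 1 ≤ x → x ≤ n → x ∈ [1⋯ n ]
∈-[1⋯]⁺ {suc x} _ x≤n = ∈-applyUpTo⁺ suc x≤n

∈-[1⋯]⁻ : ∀ {x n} → x ∈ [1⋯ n ] → 1 ≤ x × x ≤ n
∈-[1⋯]⁻ x∈ with _ , i<n , refl ← ∈-applyUpTo⁻ suc x∈ = z<s , i<n

[1⋯]-Unique : ∀ n → Unique [1⋯ n ]
[1⋯]-Unique n = Unique.applyUpTo⁺₁ suc n (λ i<j _ → <⇒≢ (s≤s i<j))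

module _ {c : List ℕ} where

  filter-[1⋯]-suc : ∀ m → filter (_∉? c) [1⋯ suc m ] ≡
                              filter (_∉? c) [1⋯ m ] ++ filter (_∉? c) [ suc m ]
  filter-[1⋯]-suc m = trans (cong (filter (_∉? c)) (sym (applyUpTo-∷ʳ suc m)))
    (filter-++ (_∉? c) [1⋯ m ] _)

  missing-suc-∉ : ∀ {m} → suc m ∉ c → missing (suc m) c ≡ suc (missing m c)
  missing-suc-∉ {m} m∉c = begin
    missing (suc m) c                             ≡⟨ cong length (filter-[1⋯]-suc m) ⟩
    length (filter (_∉? c) [1⋯ m ] ++ filter (_∉? c) [ suc m ])
      ≡⟨ length-++ (filter (_∉? c) [1⋯ m ]) ⟩
    missing m c + length (filter (_∉? c) [ suc m ])
      ≡⟨ cong (λ l → missing m c + length l) (filter-accept (_∉? c) m∉c) ⟩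
    missing m c + 1                               ≡⟨ +-comm (missing m c) 1 ⟩
    suc (missing m c)                             ∎
    where open ≡-Reasoning

  missing-suc-∈ : ∀ {m} → suc m ∈ c → missing (suc m) c ≡ missing m c
  missing-suc-∈ {m} m∈c = begin
    missing (suc m) c                             ≡⟨ cong length (filter-[1⋯]-suc m) ⟩
    length (filter (_∉? c) [1⋯ m ] ++ filter (_∉? c) [ suc m ])
      ≡⟨ length-++ (filter (_∉? c) [1⋯ m ]) ⟩
    missing m c + length (filter (_∉? c) [ suc m ])
      ≡⟨ cong (λ l → missing m c + length l) (filter-reject (_∉? c) (contradiction m∈c)) ⟩
    missing m c + 0                               ≡⟨ +-identityʳ (missing m c) ⟩
    missing m c                                   ∎
    where open ≡-Reasoning

  missing-≤-suc : ∀ m → missing m c ≤ missing (suc m) c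
  missing-≤-suc m with suc m ∈? c
  ... | yes m∈c = ≤-reflexive (sym (missing-suc-∈ m∈c))
  ... | no  m∉c = ≤-trans (n≤1+n _) (≤-reflexive (sym (missing-suc-∉ m∉c)))

  missing-monoˡ : ∀ {m n} → m ≤ n → missing m c ≤ missing n c
  missing-monoˡ {m} m≤n with ≤⇒≤′ m≤n
  ... | ≤′-refl           = ≤-refl
  ... | ≤′-step {n} m≤′n = ≤-trans (missing-monoˡ (≤′⇒≤ m≤′n)) (missing-≤-suc n)

  ∈-missing⁻ : ∀ {m z} → z ∈ filter (_∉? c) [1⋯ m ] → z ∉ c × 1 ≤ z × z ≤ m
  ∈-missing⁻ {m} z∈ = let z∈[m] , z∉c = ∈-filter⁻ (_∉? c) {xs = [1⋯ m ]} z∈ in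
    z∉c , ∈-[1⋯]⁻ z∈[m]

  1≤missing⇒∃ : ∀ m → 1 ≤ missing m c → ∃ λ z → z ∉ c × 1 ≤ z × z ≤ m
  1≤missing⇒∃ m 1≤ with filter (_∉? c) [1⋯ m ] in eq
  ... | z ∷ _ = z , ∈-missing⁻ (subst (z ∈_) (sym eq) (here refl))

  2≤missing⇒∃₂ : ∀ m → 2 ≤ missing m c →
    ∃₂ λ u v → u ≢ v × (u ∉ c × 1 ≤ u × u ≤ m) × (v ∉ c × 1 ≤ v × v ≤ m)
  2≤missing⇒∃₂ m 2≤ with filter (_∉? c) [1⋯ m ] in eq
  ... | _ ∷ [] with s≤s () ← 2≤
  ... | u ∷ v ∷ _
    with (u≢v ∷ _) ∷ _ ← subst Unique eq (Unique.filter⁺ (_∉? c) ([1⋯]-Unique m)) =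
    u , v , u≢v , ∈-missing⁻ (subst (u ∈_) (sym eq) (here refl)) ,
    ∈-missing⁻ (subst (v ∈_) (sym eq) (there (here refl)))

  ∉-∷ʳ⁺ : ∀ {x z} → x ∉ c → x ≢ z → x ∉ c ++ [ z ]
  ∉-∷ʳ⁺ x∉c x≢z x∈ with ∈-++⁻ c x∈
  ... | inj₁ x∈c         = x∉c x∈c
  ... | inj₂ (here x≡z) = x≢z x≡z

module _ {c : List ℕ} where

  missing-∷ʳ-≤ : ∀ z m → missing m (c ++ [ z ]) ≤ missing m c
  missing-∷ʳ-≤ z zero = z≤n
  missing-∷ʳ-≤ z (suc m) with suc m ∈? c | suc m ∈? (c ++ [ z ])
  ... | yes p | yes q rewrite missing-suc-∈ p | missing-suc-∈ q = missing-∷ʳ-≤ z m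
  ... | yes p | no ¬q = contradiction (∈-++⁺ˡ p) ¬q
  ... | no ¬p | yes q rewrite missing-suc-∉ ¬p | missing-suc-∈ q = m≤n⇒m≤1+n (missing-∷ʳ-≤ z m)
  ... | no ¬p | no ¬q rewrite missing-suc-∉ ¬p | missing-suc-∉ ¬q = s≤s (missing-∷ʳ-≤ z m)

  missing-∷ʳ-≥ : ∀ {z} m → m < z → missing m c ≤ missing m (c ++ [ z ])
  missing-∷ʳ-≥ zero    _   = z≤n
  missing-∷ʳ-≥ {z} (suc m) m<z with suc m ∈? c
  ... | yes p rewrite missing-suc-∈ p | missing-suc-∈ (∈-++⁺ˡ {ys = [ z ]} p) =
    missing-∷ʳ-≥ m (<⇒≤ m<z)
  ... | no ¬p rewrite missing-suc-∉ ¬p | missing-suc-∉ (∉-∷ʳ⁺ ¬p (<⇒≢ m<z)) =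
    s≤s (missing-∷ʳ-≥ m (<⇒≤ m<z))

  missing-∷ʳ-< : ∀ {z} m → z ∉ c → 1 ≤ z → z ≤ m → missing m (c ++ [ z ]) < missing m c
  missing-∷ʳ-< zero z∉c 1≤z z≤0 = contradiction (≤-trans 1≤z z≤0) λ ()
  missing-∷ʳ-< {z} (suc m) z∉c 1≤z z≤ with m≤n⇒m<n∨m≡n z≤
  ... | inj₂ refl rewrite missing-suc-∉ z∉c | missing-suc-∈ (∈-++⁺ʳ c {ys = [ suc m ]} (here refl)) =
    s≤s (missing-∷ʳ-≤ (suc m) m)
  ... | inj₁ z<   with suc m ∈? c
  ...   | yes p rewrite missing-suc-∈ p | missing-suc-∈ (∈-++⁺ˡ {ys = [ z ]} p) =
    missing-∷ʳ-< m z∉c 1≤z (s≤s⁻¹ z<)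
  ...   | no ¬p rewrite missing-suc-∉ ¬p | missing-suc-∉ (∉-∷ʳ⁺ ¬p (<⇒≢ z< ∘ sym)) =
    s≤s (missing-∷ʳ-< m z∉c 1≤z (s≤s⁻¹ z<))

-- Growing a prefix

⊆-∷ʳ⁻ : {xs : List A} (c : List A) {z : A} → xs ⊆ c ++ [ z ] →
        xs ⊆ c ⊎ (∃ λ ys → xs ≡ ys ++ [ z ] × ys ⊆ c)
⊆-∷ʳ⁻ []      (_ ∷ʳ p)    = inj₁ p
⊆-∷ʳ⁻ []      (refl ∷ []) = inj₂ ([] , refl , [])
⊆-∷ʳ⁻ (w ∷ c) (_ ∷ʳ p) with ⊆-∷ʳ⁻ c p
... | inj₁ q             = inj₁ (w ∷ʳ q)
... | inj₂ (ys , eq , q) = inj₂ (ys , eq , w ∷ʳ q)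
⊆-∷ʳ⁻ (w ∷ c) (refl ∷ p) with ⊆-∷ʳ⁻ c p
... | inj₁ q               = inj₁ (refl ∷ q)
... | inj₂ (ys , refl , q) = inj₂ (w ∷ ys , refl , refl ∷ q)

∈-pair : {u v : A} {w : List A} → u ≢ v → u ∈ w → v ∈ w →
         (u ∷ v ∷ []) ⊆ w ⊎ (v ∷ u ∷ []) ⊆ w
∈-pair u≢v (here refl) (here refl) = contradiction refl u≢v
∈-pair u≢v (here refl) (there q)   = inj₁ (refl ∷ from∈ q)
∈-pair u≢v (there p)   (here refl) = inj₂ (refl ∷ from∈ p)
∈-pair u≢v (there p)   (there q) with ∈-pair u≢v p q
... | inj₁ r = inj₁ (_ ∷ʳ r)
... | inj₂ r = inj₂ (_ ∷ʳ r)

record Admissible (c : List ℕ) : Set where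
  field
    ascents : ∀ {x} → Ascents c x → missing x c ≤ 1
    threats : ∀ {x} → Threats c x → missing x c ≤ 0
    ¬bad    : ¬ Bad c

open Admissible

Extends : ℕ → List ℕ → Pred (List ℕ) 0ℓ
Extends n c τ = τ ↭ [1⋯ n ] × (∃ λ w → τ ≡ c ++ w) × ¬ Bad τ

Unique-resp-↭ : {xs ys : List ℕ} → xs ↭ ys → Unique xs → Unique ys
Unique-resp-↭ p = PermS.Unique-resp-↭ (setoid ℕ) (↭⇒↭ₛ p)

Extends⇒Unique : ∀ {n c τ} → Extends n c τ → Unique τ
Extends⇒Unique {n} (perm , _) = Unique-resp-↭ (↭-sym perm) ([1⋯]-Unique n)

-- Values missing from `c` must occur in the remainder `w`. Two of them below the start of an
-- ascent, or one below the start of a threat, would complete a forbidden pattern.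
Extends⇒Admissible : ∀ {n c τ} → Extends n c τ → Admissible c
Extends⇒Admissible {n} {c} (perm , (w , refl) , ¬b) = record
  { ascents = λ (y , p , x<y) → ≮⇒≥ λ 2≤ →
      let u , v , u≢v , fu , fv = 2≤missing⇒∃₂ _ 2≤
          x∈c = to∈ p
      in case ∈-pair u≢v (later x∈c fu) (later x∈c fv) of λ where
        (inj₁ q) → ¬b (_ , _ , _ , _ , Sub.++⁺ p q , x<y , smaller x∈c fu , smaller x∈c fv)
        (inj₂ q) → ¬b (_ , _ , _ , _ , Sub.++⁺ p q , x<y , smaller x∈c fv , smaller x∈c fu)
  ; threats = λ (y , u , p , x<y , u<x) → ≮⇒≥ λ 1≤ →
      let z , fz = 1≤missing⇒∃ _ 1≤
          x∈c = to∈ p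
      in ¬b (_ , _ , _ , _ , Sub.++⁺ p (from∈ (later x∈c fz)) , x<y , u<x , smaller x∈c fz)
  ; ¬bad = λ (x , y , u , v , p , rest) → ¬b (x , y , u , v , Sub.++⁺ʳ w p , rest)
  }
  where
  later : ∀ {x z} → x ∈ c → z ∉ c × 1 ≤ z × z ≤ x → z ∈ w
  later x∈c (z∉c , 1≤z , z≤x)
    with _ , x≤n ← ∈-[1⋯]⁻ (∈-resp-↭ perm (∈-++⁺ˡ x∈c))
    with ∈-++⁻ c (∈-resp-↭ (↭-sym perm) (∈-[1⋯]⁺ 1≤z (≤-trans z≤x x≤n)))
  ... | inj₁ z∈c = contradiction z∈c z∉c
  ... | inj₂ z∈w = z∈w

  smaller : ∀ {x z} → x ∈ c → z ∉ c × 1 ≤ z × z ≤ x → z < x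
  smaller x∈c (z∉c , _ , z≤x) = ≤∧≢⇒< z≤x λ { refl → z∉c x∈c }

-- The value y can be placed next exactly when FreeBelow c y holds.
FreeBelow : List ℕ → ℕ → Set
FreeBelow c y = ∀ x → x ∈ c → x < y → missing x c ≤ 1

Admissible-∷ʳ : ∀ {c y} → y ∉ c → 1 ≤ y → FreeBelow c y → Admissible c → Admissible (c ++ [ y ])
Admissible-∷ʳ {c} {y} y∉c 1≤y free adm = record
  { ascents = λ {x} (z , p , x<z) → ≤-trans (missing-∷ʳ-≤ {c} y x) (case ⊆-∷ʳ⁻ c p of λ where
      (inj₁ q) → ascents adm (z , q , x<z)
      (inj₂ (ys , eq , q)) → case ∷ʳ-injective (_ ∷ []) ys eq of λ where
        (refl , refl) → free _ (to∈ q) x<z)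
  ; threats = λ {x} (z , u , p , x<z , u<x) → case ⊆-∷ʳ⁻ c p of λ where
      (inj₁ q) → ≤-trans (missing-∷ʳ-≤ {c} y x) (threats adm (z , u , q , x<z , u<x))
      (inj₂ (ys , eq , q)) → case ∷ʳ-injective (_ ∷ _ ∷ []) ys eq of λ where
        (refl , refl) → s≤s⁻¹ (≤-trans (missing-∷ʳ-< {c} x y∉c 1≤y (<⇒≤ u<x))
                                     (ascents adm (z , q , x<z)))
  ; ¬bad = λ (x , z , u , v , p , x<z , u<x , v<x) → case ⊆-∷ʳ⁻ c p of λ where
      (inj₁ q) → ¬bad adm (x , z , u , v , q , x<z , u<x , v<x)
      (inj₂ (ys , eq , q)) → case ∷ʳ-injective (_ ∷ _ ∷ _ ∷ []) ys eq of λ where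
        (refl , refl) → <⇒≱ (≤-trans z<s (missing-∷ʳ-< {c} x y∉c 1≤y (<⇒≤ v<x)))
                             (threats adm (z , u , q , x<z , u<x))
  }

-- Every `x < y` in `c` starts an ascent ending in the appended `y`, and `y` is too large to change
-- the count below `x`.
Admissible-∷ʳ⁻ : ∀ {c y} → Admissible (c ++ [ y ]) → FreeBelow c y
Admissible-∷ʳ⁻ {c} {y} adm x x∈c x<y =
  ≤-trans (missing-∷ʳ-≥ x x<y) (ascents adm (y , Sub.++⁺ (from∈ x∈c) (refl ∷ []) , x<y))

-- Used values as lists of booleans

bits : List ℕ → ℕ → ℕ → List Bool
bits c a zero    = []
bits c a (suc m) = does (suc a ∈? c) ∷ bits c (suc a) m

bits-+ : ∀ c a k m → bits c a (k + m) ≡ bits c a k ++ bits c (a + k) m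
bits-+ c a zero    m rewrite +-identityʳ a = refl
bits-+ c a (suc k) m rewrite +-suc a k = cong (_ ∷_) (bits-+ c (suc a) k m)

bits-∷ʳ : ∀ c a → bits c 0 (suc a) ≡ bits c 0 a ++ [ does (suc a ∈? c) ]
bits-∷ʳ c a = trans (cong (bits c 0) (+-comm 1 a)) (bits-+ c 0 a 1)

bits-cong : ∀ {c d} a m → (∀ {x} → a < x → x ≤ a + m → x ∈ c ⇔ x ∈ d) → bits c a m ≡ bits d a m
bits-cong a zero    c⇔d = refl
bits-cong {c} {d} a (suc m) c⇔d = cong₂ _∷_
  (does-⇔ (c⇔d ≤-refl (m<m+n a z<s)) (suc a ∈? c) (suc a ∈? d))
  (bits-cong (suc a) m λ lt le → c⇔d (<⇒≤ lt) (≤-trans le (≤-reflexive (sym (+-suc a m)))))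

∈-∷ʳ-⇔ : ∀ {c : List ℕ} {x z} → x ≢ z → x ∈ c ++ [ z ] ⇔ x ∈ c
∈-∷ʳ-⇔ {c} x≢z = mk⇔ (λ p → case ∈-++⁻ c p of λ where
                        (inj₁ q)        → q
                        (inj₂ (here q)) → contradiction q x≢z)
                     ∈-++⁺ˡ

bits-place : ∀ c a m →
  bits (c ++ [ suc a ]) 0 (a + suc m) ≡ bits c 0 a ++ true ∷ bits c (suc a) m
bits-place c a m = trans (bits-+ (c ++ [ suc a ]) 0 a (suc m)) (cong₂ _++_
  (bits-cong 0 a λ _ x≤a → ∈-∷ʳ-⇔ (<⇒≢ (s≤s x≤a)))
  (cong₂ _∷_ (dec-true (suc a ∈? (c ++ [ suc a ])) (∈-++⁺ʳ c (here refl)))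
             (bits-cong (suc a) m λ lt _ → ∈-∷ʳ-⇔ (<⇒≢ lt ∘ sym))))

bits-full : ∀ c a m → (∀ {x} → a < x → x ≤ a + m → x ∈ c) → completions (bits c a m) ≡ 1
bits-full c a zero    full = refl
bits-full c a (suc m) full
  rewrite dec-true (suc a ∈? c) (full ≤-refl (m<m+n a z<s)) =
  bits-full c (suc a) m λ lt le → full (<⇒≤ lt) (≤-trans le (≤-reflexive (sym (+-suc a m))))

false∈bits : ∀ c a m {z} → z ∉ c → a < z → z ≤ a + m → false ∈ bits c a m
false∈bits c a zero z∉c a<z z≤ = contradiction (subst (_ ≤_) (+-identityʳ a) z≤) (<⇒≱ a<z)
false∈bits c a (suc m) z∉c a<z z≤ with m≤n⇒m<n∨m≡n a<z
... | inj₂ refl = here (sym (dec-false (suc a ∈? c) z∉c))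
... | inj₁ a+1<z = there (false∈bits c (suc a) m z∉c a+1<z (≤-trans z≤ (≤-reflexive (+-suc a m))))

completionsWith-true : ∀ p q b → p + q ≤ 1 →
  completionsWith p q (true ∷ b) ≡ completionsWith (p + q) 0 b
completionsWith-true 0 0 b _ = refl
completionsWith-true 0 1 b _ = *-identityˡ _
completionsWith-true 1 0 b _ = *-identityˡ _
completionsWith-true 0 (suc (suc _)) b (s≤s ())
completionsWith-true 1 (suc _) b (s≤s ())
completionsWith-true (suc (suc _)) q b (s≤s ())

completionsWith-false : ∀ p q b → completionsWith p q (false ∷ b) ≡ completionsWith p (suc q) b
completionsWith-false zero    zero    b = refl
completionsWith-false zero    (suc q) b = refl
completionsWith-false (suc p) q       b = refl

-- Completions classified by their next entry `y`; the restriction `a < y` lets the candidates be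
-- scanned in increasing order.
Extends-∷ʳ : ∀ n c a → Pred (List ℕ) 0ℓ
Extends-∷ʳ n c a τ = ∃ λ y → a < y × y ∉ c × Extends n (c ++ [ y ]) τ

module _ (n : ℕ) (c : List ℕ)
  (size : ∀ {y} → 1 ≤ y → y ≤ n → y ∉ c → FreeBelow c y →
          HasSize (Extends n (c ++ [ y ])) (completions (bits (c ++ [ y ]) 0 n))) where

  -- Here p counts the unused values below the largest used value that is at most a, and q the
  -- remaining unused values that are at most a.
  count-next : ∀ m a p q → a + m ≡ n → missing a c ≡ p + q → (p ≤ 1 ⇔ FreeBelow c (suc a)) →
    (p ≤ 1 → ∀ b → completions (bits c 0 a ++ b) ≡ completionsWith p q b) →
    HasSize (Extends-∷ʳ n c a) (nextCompletions p q (bits c a m))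
  count-next zero a p q refl _ _ _ = HasSize-∅ λ where
    _ (y , a<y , _ , perm , (w , refl) , _) →
      <⇒≱ a<y (subst (y ≤_) (+-identityʳ a)
        (∈-[1⋯]⁻ (∈-resp-↭ perm (∈-++⁺ˡ (∈-++⁺ʳ c (here refl)))) .proj₂))
  count-next (suc m) a p q eqn miss free weight with suc a ∈? c
  ... | yes a∈c = HasSize-⇔
    (λ τ → mk⇔ (λ (y , a<y , rest) → y , <⇒≤ a<y , rest)
               (λ (y , a<y , y∉c , ext) → y , ≤∧≢⇒< a<y (λ { refl → y∉c a∈c }) , y∉c , ext))
    (count-next m (suc a) (p + q) 0 (trans (sym (+-suc a m)) eqn)
      (trans (missing-suc-∈ a∈c) (trans miss (sym (+-identityʳ _))))
      (mk⇔ ⇒ ⇐)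
      weight′)
    where
    ⇒ : p + q ≤ 1 → FreeBelow c (suc (suc a))
    ⇒ p+q≤1 x x∈c x< with m≤n⇒m<n∨m≡n (s≤s⁻¹ x<)
    ... | inj₁ x<a  = to free (≤-trans (m≤m+n p q) p+q≤1) x x∈c x<a
    ... | inj₂ refl = subst (_≤ 1) (sym (trans (missing-suc-∈ a∈c) miss)) p+q≤1

    ⇐ : FreeBelow c (suc (suc a)) → p + q ≤ 1
    ⇐ f = subst (_≤ 1) (trans (missing-suc-∈ a∈c) miss) (f (suc a) a∈c ≤-refl)

    weight′ : p + q ≤ 1 → ∀ b → completions (bits c 0 (suc a) ++ b) ≡ completionsWith (p + q) 0 b
    weight′ p+q≤1 b = begin
      completions (bits c 0 (suc a) ++ b)
        ≡⟨ cong (λ l → completions (l ++ b)) (trans (bits-∷ʳ c a)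
             (cong (λ d → bits c 0 a ++ [ d ]) (dec-true (suc a ∈? c) a∈c))) ⟩
      completions ((bits c 0 a ++ [ true ]) ++ b) ≡⟨ cong completions (++-assoc (bits c 0 a) _ b) ⟩
      completions (bits c 0 a ++ true ∷ b)        ≡⟨ weight (≤-trans (m≤m+n p q) p+q≤1) (true ∷ b) ⟩
      completionsWith p q (true ∷ b)              ≡⟨ completionsWith-true p q b p+q≤1 ⟩
      completionsWith (p + q) 0 b                 ∎
      where open ≡-Reasoning
  ... | no a∉c = place
    where
    rest : HasSize (Extends-∷ʳ n c (suc a)) (nextCompletions p (suc q) (bits c (suc a) m))
    rest = count-next m (suc a) p (suc q) (trans (sym (+-suc a m)) eqn)
      (trans (missing-suc-∉ a∉c) (trans (cong suc miss) (sym (+-suc p q))))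
      (mk⇔ (λ p≤1 x x∈c x< → to free p≤1 x x∈c (≤∧≢⇒< (s≤s⁻¹ x<) λ { refl → a∉c x∈c }))
           (λ f → from free λ x x∈c x< → f x x∈c (m≤n⇒m≤1+n x<)))
      λ p≤1 b → begin
        completions (bits c 0 (suc a) ++ b)
          ≡⟨ cong (λ l → completions (l ++ b)) (trans (bits-∷ʳ c a)
               (cong (λ d → bits c 0 a ++ [ d ]) (dec-false (suc a ∈? c) a∉c))) ⟩
        completions ((bits c 0 a ++ [ false ]) ++ b) ≡⟨ cong completions (++-assoc (bits c 0 a) _ b) ⟩
        completions (bits c 0 a ++ false ∷ b)        ≡⟨ weight p≤1 (false ∷ b) ⟩
        completionsWith p q (false ∷ b)              ≡⟨ completionsWith-false p q b ⟩
        completionsWith p (suc q) b                  ∎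
      where open ≡-Reasoning

    place : HasSize (Extends-∷ʳ n c a) (nextCompletions p q (false ∷ bits c (suc a) m))
    place with p ≤? 1
    ... | yes p≤1 = HasSize-⇔
      (λ τ → mk⇔ (λ where
                    (inj₁ ext)                → suc a , ≤-refl , a∉c , ext
                    (inj₂ (y , a<y , others)) → y , <⇒≤ a<y , others)
                 (λ (y , a<y , y∉c , ext) → case m≤n⇒m<n∨m≡n a<y of λ where
                    (inj₁ lt)   → inj₂ (y , lt , y∉c , ext)
                    (inj₂ refl) → inj₁ ext))
      (HasSize-⊎
        -- The entry right after `c` tells the two cases apart.
        (λ where
          τ (_ , (w , eq) , _) (y , a<y , _ , _ , (w′ , eq′) , _) →
            <⇒≢ a<y (∷-injectiveˡ (++-cancelˡ c _ _
              (trans (sym (++-assoc c _ w)) (trans (trans (sym eq) eq′) (++-assoc c _ w′))))))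
        (subst (HasSize _)
          (trans (cong completions (trans (cong (bits (c ++ [ suc a ]) 0) (sym eqn))
                                           (bits-place c a m)))
                 (weight p≤1 _))
          (size z<s (subst (a <_) eqn (m<m+n a z<s)) a∉c (to free p≤1)))
        rest)
    ... | no p≰1 = HasSize-⇔
      (λ τ → mk⇔ (λ (y , a<y , others) → y , <⇒≤ a<y , others)
                 (λ (y , a<y , y∉c , ext) → case m≤n⇒m<n∨m≡n a<y of λ where
                    (inj₁ lt)   → y , lt , y∉c , ext
                    (inj₂ refl) → contradiction
                      (from free (Admissible-∷ʳ⁻ (Extends⇒Admissible ext))) p≰1))
      rest

Extends-full : ∀ {n c} → Unique c → (∀ {x} → x ∈ c → x ∈ [1⋯ n ]) → Admissible c →
               (∀ {x} → 1 ≤ x → x ≤ n → x ∈ c) → HasSize (Extends n c) 1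
Extends-full {n} {c} c! c⊆ adm full =
  [ c ] , [] ∷ [] ,
  (λ τ → mk⇔ (λ { (here refl) → perm , ([] , sym (++-identityʳ c)) , ¬bad adm }) only) , refl
  where
  perm : c ↭ [1⋯ n ]
  perm = ∼bag⇒↭ (unique∧set⇒bag c! ([1⋯]-Unique n)
    (mk⇔ c⊆ (λ x∈ → let 1≤x , x≤n = ∈-[1⋯]⁻ x∈ in full 1≤x x≤n)))

  only : ∀ {τ} → Extends n c τ → τ ∈ [ c ]
  only (perm′ , ([] , refl) , _) = here (++-identityʳ c)
  only (perm′ , (y ∷ w , refl) , _) = contradiction
    (+-cancelˡ-≡ (length c) (suc (length w)) 0 (trans (sym (length-++ c))
      (trans (↭-length (↭-trans perm′ (↭-sym perm))) (sym (+-identityʳ _))))) λ ()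

count-Extends : ∀ k {n c} → missing n c ≤ k → Unique c → (∀ {x} → x ∈ c → x ∈ [1⋯ n ]) →
                Admissible c → HasSize (Extends n c) (completions (bits c 0 n))
count-Extends k {n} {c} m≤k c! c⊆ adm with missing n c ≤? 0
... | yes m≤0 = subst (HasSize _) (sym (bits-full c 0 n full)) (Extends-full c! c⊆ adm full)
  where
  full : ∀ {x} → 1 ≤ x → x ≤ n → x ∈ c
  full {x} 1≤x x≤n with x ∈? c
  ... | yes x∈c = x∈c
  ... | no  x∉c = contradiction m≤0 (<⇒≱ (≤-trans z<s (missing-∷ʳ-< n x∉c 1≤x x≤n)))
count-Extends zero    m≤k c! c⊆ adm | no m≰0 = contradiction m≤k m≰0
count-Extends (suc k) {n} {c} m≤k c! c⊆ adm | no m≰0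
  with z , z∉c , 1≤z , z≤ ← 1≤missing⇒∃ n (≰⇒> m≰0) =
  subst (HasSize _) (completions-step (bits c 0 n) (false∈bits c 0 n z∉c 1≤z z≤))
    (HasSize-⇔ (λ τ → mk⇔ shorten lengthen)
      -- The scan starts below all values, where nothing is counted and nothing obstructs.
      (count-next n c size n 0 0 0 refl refl
        (mk⇔ (λ _ _ x∈c x<1 → contradiction x<1 (≤⇒≯ (∈-[1⋯]⁻ (c⊆ x∈c) .proj₁))) (λ _ → z≤n))
        (λ _ _ → refl)))
  where
  size : ∀ {y} → 1 ≤ y → y ≤ n → y ∉ c → FreeBelow c y →
         HasSize (Extends n (c ++ [ y ])) (completions (bits (c ++ [ y ]) 0 n))
  size {y} 1≤y y≤n y∉c free = count-Extends k
    (s≤s⁻¹ (≤-trans (missing-∷ʳ-< n y∉c 1≤y y≤n) m≤k))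
    (Unique.++⁺ c! ([] ∷ []) λ { (y∈c , here refl) → y∉c y∈c })
    (λ x∈ → case ∈-++⁻ c x∈ of λ where
      (inj₁ x∈c)         → c⊆ x∈c
      (inj₂ (here refl)) → ∈-[1⋯]⁺ 1≤y y≤n)
    (Admissible-∷ʳ y∉c 1≤y free adm)

  shorten : ∀ {τ} → Extends-∷ʳ n c 0 τ → Extends n c τ
  shorten (y , _ , _ , perm , (w , eq) , ¬b) = perm , (y ∷ w , trans eq (++-assoc c [ y ] w)) , ¬b

  lengthen : ∀ {τ} → Extends n c τ → Extends-∷ʳ n c 0 τ
  lengthen (perm , ([] , refl) , _) = contradiction
    (subst (z ∈_) (++-identityʳ c) (∈-resp-↭ (↭-sym perm) (∈-[1⋯]⁺ 1≤z z≤))) z∉c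
  lengthen ext@(perm , (y ∷ w , refl) , ¬b) =
    y , ∈-[1⋯]⁻ (∈-resp-↭ perm (∈-++⁺ʳ c (here refl))) .proj₁ ,
    (λ y∈c → Unique-++⇒Disjoint c (Extends⇒Unique ext) y∈c (here refl)) ,
    perm , (w , sym (++-assoc c [ y ] w)) , ¬b
    where
    Unique-++⇒Disjoint : ∀ xs {ys} {x : ℕ} → Unique (xs ++ ys) → x ∈ xs → ¬ x ∈ ys
    Unique-++⇒Disjoint (x ∷ xs) (x∉ ∷ _)  (here refl) x∈ys = All.lookup x∉ (∈-++⁺ʳ xs x∈ys) refl
    Unique-++⇒Disjoint (x ∷ xs) (_ ∷ u) (there x∈xs)  x∈ys = Unique-++⇒Disjoint xs u x∈xs x∈ys

-- Gaps

applyUpTo-cong : {f g : ℕ → ℕ} → f ≗ g → ∀ m → applyUpTo f m ≡ applyUpTo g m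
applyUpTo-cong f≗g zero    = refl
applyUpTo-cong f≗g (suc m) = cong₂ _∷_ (f≗g 0) (applyUpTo-cong (f≗g ∘ suc) m)

module _ (n : ℕ) where

  gaps : ℕ → List ℕ → List ℕ
  gaps a []       = [ suc n ∸ a ]
  gaps a (x ∷ xs) = (x ∸ a) ∷ gaps x xs

  -- The differences telescope to `n + 1 - a`, and truncation at 0 can only increase their sum.
  n<a+sum-gaps : ∀ a xs → n < a + sum (gaps a xs)
  n<a+sum-gaps a [] rewrite +-identityʳ (suc n ∸ a) = m≤n+m∸n (suc n) a
  n<a+sum-gaps a (x ∷ xs) = ≤-trans (n<a+sum-gaps x xs)
    (≤-trans (+-monoˡ-≤ (sum (gaps x xs)) (m≤n+m∸n x a)) (≤-reflexive (+-assoc a (x ∸ a) _)))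

  -- `ordered` for an already sorted list, with the initial 0 generalised to `a` for the induction.
  nth : ℕ → List ℕ → ℕ → ℕ
  nth a xs zero    = a
  nth a xs (suc i) = fromMaybe (suc n) (head (drop i xs))

  nth-∷ : ∀ a x xs i → nth a (x ∷ xs) (suc i) ≡ nth x xs i
  nth-∷ a x xs zero    = refl
  nth-∷ a x xs (suc i) = refl

  nth-gaps : ∀ a xs → applyUpTo (λ i → nth a xs (suc i) ∸ nth a xs i) (suc (length xs)) ≡ gaps a xs
  nth-gaps a []       = refl
  nth-gaps a (x ∷ xs) = cong (x ∸ a ∷_) (trans
    (applyUpTo-cong (λ i → cong₂ _∸_ (nth-∷ a x xs (suc i)) (nth-∷ a x xs i)) (suc (length xs)))
    (nth-gaps x xs))

gapProduct : List ℕ → ℕ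
gapProduct = product ∘ map (λ g → 𝕊 (g ∸ 1))

gapWeight : List ℕ → ℕ
gapWeight []                 = 1
gapWeight (0 ∷ gs)           = gapWeight gs
gapWeight (1 ∷ gs)           = gapWeight gs
gapWeight (suc (suc g) ∷ gs) = 𝕊 g * gapProduct gs

usedValues : List ℕ → ℕ → ℕ → List ℕ
usedValues c a zero    = []
usedValues c a (suc m) with suc a ∈? c
... | yes _ = suc a ∷ usedValues c (suc a) m
... | no  _ = usedValues c (suc a) m

usedValues-> : ∀ c a m → All (a <_) (usedValues c a m)
usedValues-> c a zero    = []
usedValues-> c a (suc m) with suc a ∈? c
... | yes _ = ≤-refl ∷ All.map <⇒≤ (usedValues-> c (suc a) m)
... | no  _ = All.map <⇒≤ (usedValues-> c (suc a) m)

usedValues-increasing : ∀ c a m → AllPairs _<_ (usedValues c a m)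
usedValues-increasing c a zero    = []
usedValues-increasing c a (suc m) with suc a ∈? c
... | yes _ = usedValues-> c (suc a) m ∷ usedValues-increasing c (suc a) m
... | no  _ = usedValues-increasing c (suc a) m

∈-usedValues⁻ : ∀ c a m {x} → x ∈ usedValues c a m → x ∈ c
∈-usedValues⁻ c a (suc m) x∈ with suc a ∈? c
∈-usedValues⁻ c a (suc m) (here refl) | yes p = p
∈-usedValues⁻ c a (suc m) (there x∈)  | yes _ = ∈-usedValues⁻ c (suc a) m x∈
∈-usedValues⁻ c a (suc m) x∈          | no  _ = ∈-usedValues⁻ c (suc a) m x∈

∈-usedValues⁺ : ∀ c a m {x} → x ∈ c → a < x → x ≤ a + m → x ∈ usedValues c a m
∈-usedValues⁺ c a zero x∈c a<x x≤ = contradiction (subst (_ ≤_) (+-identityʳ a) x≤) (<⇒≱ a<x)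
∈-usedValues⁺ c a (suc m) {x} x∈c a<x x≤ with suc a ∈? c | m≤n⇒m<n∨m≡n a<x
... | yes _ | inj₂ refl = here refl
... | no ¬p | inj₂ refl = contradiction x∈c ¬p
... | yes _ | inj₁ lt   = there (∈-usedValues⁺ c (suc a) m x∈c lt (subst (x ≤_) (+-suc a m) x≤))
... | no  _ | inj₁ lt   = ∈-usedValues⁺ c (suc a) m x∈c lt (subst (x ≤_) (+-suc a m) x≤)

-- `usedValues` is an increasing rearrangement of `c`, and sorted rearrangements are unique.
sort≡usedValues : ∀ {n c} → Unique c → (∀ {x} → x ∈ c → x ∈ [1⋯ n ]) → sort c ≡ usedValues c 0 n
sort≡usedValues {n} {c} c! c⊆ = Pointwise-≡⇒≡
  (↗↭↗⇒≋ ≤-totalOrder (sort-↗ c)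
    (AllPairs⇒Sorted ≤-totalOrder (AllPairs.map <⇒≤ (usedValues-increasing c 0 n)))
    (↭⇒↭ₛ (↭-trans (sort-↭ c) (∼bag⇒↭ (unique∧set⇒bag c!
      (AllPairs.map <⇒≢ (usedValues-increasing c 0 n))
      (mk⇔ (λ x∈c → let 1≤x , x≤n = ∈-[1⋯]⁻ (c⊆ x∈c) in ∈-usedValues⁺ c 0 n x∈c 1≤x x≤n)
           (∈-usedValues⁻ c 0 n)))))))

∸-suc : ∀ {a x} → a < x → x ∸ a ≡ suc (x ∸ suc a)
∸-suc (s≤s a≤x) = +-∸-assoc 1 a≤x

suc[m+n]∸m : ∀ m n → suc (m + n) ∸ m ≡ suc n
suc[m+n]∸m m n = trans (+-∸-assoc 1 (m≤m+n m n)) (cong suc (m+n∸m≡n m n))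

gapWeight-≤1 : ∀ g gs → g ≤ 1 → gapWeight (g ∷ gs) ≡ gapWeight gs
gapWeight-≤1 0 gs _ = refl
gapWeight-≤1 1 gs _ = refl
gapWeight-≤1 (suc (suc _)) gs (s≤s ())

-- Here `a` is the lower end of the current gap, `e` the value reached by the scan and `k` their
-- distance. A gap closing at `e + 1` has length `k + 1`, hence the factor `𝕊 k`.
completionsAfter-gaps : ∀ c n m a k e → e ≡ a + k → e + m ≡ n →
  completionsAfter k (bits c e m) ≡ gapProduct (gaps n a (usedValues c e m))
completionsAfter-gaps c n zero a k e refl refl = trans (sym (*-identityʳ (𝕊 k)))
  (cong (λ g → 𝕊 (g ∸ 1) * 1)
        (sym (trans (cong (λ l → suc l ∸ a) (+-identityʳ (a + k))) (suc[m+n]∸m a k))))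
completionsAfter-gaps c n (suc m) a k e refl eq with suc e ∈? c
... | yes _ = cong₂ (λ g r → 𝕊 (g ∸ 1) * r) (sym (suc[m+n]∸m a k))
  (completionsAfter-gaps c n m (suc (a + k)) 0 (suc (a + k)) (sym (+-identityʳ _))
    (trans (sym (+-suc (a + k) m)) eq))
... | no  _ = completionsAfter-gaps c n m a (suc k) (suc (a + k)) (sym (+-suc a k))
  (trans (sym (+-suc (a + k) m)) eq)

gapWeight-shift : ∀ {g g′} gs → g ≡ suc g′ → 1 ≤ g′ → gapWeight (g ∷ gs) ≡ gapProduct (g′ ∷ gs)
gapWeight-shift {g′ = suc g′} gs refl _ = refl

gapWeight-suc : ∀ n a xs → suc a ≤ n → All (suc a <_) xs →
                gapWeight (gaps n a xs) ≡ gapProduct (gaps n (suc a) xs)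
gapWeight-suc n a []       a<n _         =
  gapWeight-shift [] (∸-suc (m≤n⇒m≤1+n a<n)) (m<n⇒0<n∸m (s≤s a<n))
gapWeight-suc n a (x ∷ xs) a<n (a<x ∷ _) =
  gapWeight-shift (gaps n x xs) (∸-suc (<⇒≤ a<x)) (m<n⇒0<n∸m a<x)

completions-gaps : ∀ c n m a → a + m ≡ n →
  completions (bits c a m) ≡ gapWeight (gaps n a (usedValues c a m))
completions-gaps c n zero a refl =
  sym (gapWeight-≤1 _ [] (≤-reflexive (suc[m+n]∸m a 0)))
completions-gaps c n (suc m) a eq with suc a ∈? c
... | yes _ = trans (completions-gaps c n m (suc a) (trans (sym (+-suc a m)) eq))
  (sym (gapWeight-≤1 (suc a ∸ a) _ (≤-reflexive (m+n∸n≡m 1 a))))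
... | no  _ = trans
  (completionsAfter-gaps c n m (suc a) 0 (suc a) (sym (+-identityʳ _)) (trans (sym (+-suc a m)) eq))
  (sym (gapWeight-suc n a _ (subst (a <_) eq (m<m+n a z<s))
                      (usedValues-> c (suc a) m)))

gapWeight->1 : ∀ g gs → 1 < g → gapWeight (g ∷ gs) ≡ 𝕊 (g ∸ 2) * gapProduct gs
gapWeight->1 (suc (suc g)) gs _ = refl
gapWeight->1 1 gs (s≤s ())

-- Pigeonhole: `m` terms of at most 1 cannot sum to more than `m`. Leading terms of at most 1 are
-- stripped until a larger one appears.
first-gap : ∀ m (f : ℕ → ℕ) → m < sum (applyUpTo f m) → ∃ λ j →
  j < m × 1 < f j × (∀ i → i < j → f i ≤ 1) ×
  gapWeight (applyUpTo f m) ≡ 𝕊 (f j ∸ 2) * gapProduct (applyUpTo (λ k → f (j + suc k)) (m ∸ suc j))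
first-gap (suc m) f m<sum with f 0 ≤? 1
... | no  ≰1 = 0 , z<s , ≰⇒> ≰1 , (λ _ ()) , gapWeight->1 (f 0) _ (≰⇒> ≰1)
... | yes ≤1
    with first-gap m (f ∘ suc) (s≤s⁻¹ (≤-trans m<sum (+-monoˡ-≤ (sum (applyUpTo (f ∘ suc) m)) ≤1)))
...   | j , j<m , 1<fj , below , eq =
  suc j , s≤s j<m , 1<fj , below′ , trans (gapWeight-≤1 (f 0) _ ≤1) eq
  where
  below′ : ∀ i → i < suc j → f i ≤ 1
  below′ zero    _   = ≤1
  below′ (suc i) i<j = below i (s≤s⁻¹ i<j)

module _ {n c} (c! : Unique c) (c⊆ : ∀ {x} → x ∈ c → x ∈ [1⋯ n ]) where

  gap≡ : ∀ i → gap n c (suc i) ≡ nth n 0 (sort c) (suc i) ∸ nth n 0 (sort c) i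
  gap≡ zero    = refl
  gap≡ (suc i) = refl

  applyUpTo-gap : applyUpTo (gap n c ∘ suc) (suc (length c)) ≡ gaps n 0 (usedValues c 0 n)
  applyUpTo-gap = begin
    applyUpTo (gap n c ∘ suc) (suc (length c))
      ≡⟨ applyUpTo-cong gap≡ (suc (length c)) ⟩
    applyUpTo (λ i → nth n 0 (sort c) (suc i) ∸ nth n 0 (sort c) i) (suc (length c))
      ≡⟨ cong (λ l → applyUpTo (λ i → nth n 0 (sort c) (suc i) ∸ nth n 0 (sort c) i) (suc l))
              (sym (↭-length (sort-↭ c))) ⟩
    applyUpTo (λ i → nth n 0 (sort c) (suc i) ∸ nth n 0 (sort c) i) (suc (length (sort c)))
      ≡⟨ nth-gaps n 0 (sort c) ⟩
    gaps n 0 (sort c)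
      ≡⟨ cong (gaps n 0) (sort≡usedValues c! c⊆) ⟩
    gaps n 0 (usedValues c 0 n) ∎
    where open ≡-Reasoning

  completions-formula : length c < n → let t = length c in
    ∃ λ j → IsMin (λ i → 1 ≤ i × i ≤ t + 1 × 1 < gap n c i) j ×
      completions (bits c 0 n) ≡ 𝕊 (gap n c j ∸ 2) * ∏[ j + 1 ⋯ t + 1 ] (λ i → 𝕊 (gap n c i ∸ 1))
  completions-formula t<n
    -- The `t + 1` gaps sum to more than `n`, which is at least `t + 1`. Positions are counted from
    -- 0 here, hence `suc j` in the result.
    with j , j≤t , 1<gap , below , eq ← first-gap (suc (length c)) (gap n c ∘ suc)
           (≤-trans (s≤s t<n) (subst (λ gs → n < sum gs) (sym applyUpTo-gap)
                                     (n<a+sum-gaps n 0 (usedValues c 0 n)))) =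
    suc j ,
    ((z<s , ≤-trans j≤t (≤-reflexive (+-comm 1 t)) , 1<gap) , least) ,
    (begin
      completions (bits c 0 n)                                ≡⟨ completions-gaps c n n 0 refl ⟩
      gapWeight (gaps n 0 (usedValues c 0 n))                 ≡⟨ cong gapWeight (sym applyUpTo-gap) ⟩
      gapWeight (applyUpTo (gap n c ∘ suc) (suc t))           ≡⟨ eq ⟩
      𝕊 (gap n c (suc j) ∸ 2) * gapProduct (applyUpTo (λ k → gap n c (suc (j + suc k))) (t ∸ j))
        ≡⟨ cong (𝕊 (gap n c (suc j) ∸ 2) *_) product≡ ⟩
      𝕊 (gap n c (suc j) ∸ 2) * ∏[ suc j + 1 ⋯ t + 1 ] h ∎)
    where
    open ≡-Reasoning
    t = length c

    h : ℕ → ℕ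
    h i = 𝕊 (gap n c i ∸ 1)

    least : ∀ i → 1 ≤ i × i ≤ t + 1 × 1 < gap n c i → suc j ≤ i
    least (suc i) (_ , _ , 1<) = s≤s (≮⇒≥ λ i<j → <⇒≱ 1< (below i i<j))

    product≡ : gapProduct (applyUpTo (λ k → gap n c (suc (j + suc k))) (t ∸ j)) ≡
               ∏[ suc j + 1 ⋯ t + 1 ] h
    product≡ = cong product (begin
      map (λ g → 𝕊 (g ∸ 1)) (applyUpTo (λ k → gap n c (suc (j + suc k))) (t ∸ j))
        ≡⟨ map-applyUpTo (λ k → gap n c (suc (j + suc k))) (λ g → 𝕊 (g ∸ 1)) (t ∸ j) ⟩
      applyUpTo (λ k → h (suc (j + suc k))) (t ∸ j)
        ≡⟨ applyUpTo-cong (λ k → cong (h ∘ suc) (sym (+-assoc j 1 k))) (t ∸ j) ⟩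
      applyUpTo (λ k → h (suc j + 1 + k)) (t ∸ j)
        ≡⟨ cong (applyUpTo (λ k → h (suc j + 1 + k))) (cong₂ _∸_ (+-comm 1 t) (+-comm 1 j)) ⟩
      applyUpTo (λ k → h (suc j + 1 + k)) (suc (t + 1) ∸ (suc j + 1)) ∎)

-- Maxima and the final count

-- `X` need not be decidable, so the maximum exists only up to double negation. If there is none,
-- the bound itself is not in `X` and can be lowered by one.
¬¬-IsMax : ∀ b {x} → (∀ y → X y → y ≤ b) → X x → ¬ ¬ (∃ λ m → IsMax X m)
¬¬-IsMax zero {x} bound Xx ¬max =
  ¬max (x , Xx , λ y Xy → ≤-trans (bound y Xy) z≤n)
¬¬-IsMax (suc b) {x} bound Xx ¬max = ¬¬-IsMax b
  (λ y Xy → s≤s⁻¹ (≤∧≢⇒< (bound y Xy) λ { refl → ¬max (suc b , Xy , bound) })) Xx ¬max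

S⇔Extends : ∀ n c τ → S n c (3412-pattern ∷ 3421-pattern ∷ []) τ ⇔ Extends n c τ
S⇔Extends n c τ = mk⇔
  (λ (perm , eq , avoids) → perm ,
    (drop (length c) τ ,
     trans (sym (take++drop≡id (length c) τ)) (cong (_++ drop (length c) τ) eq)) ,
    to (avoids⇔¬Bad τ (τ! perm)) avoids)
  (λ (perm , (w , eq) , ¬b) → perm ,
    trans (cong (take (length c)) eq) (take-++ c w) ,
    from (avoids⇔¬Bad τ (τ! perm)) ¬b)
  where
  τ! : τ ↭ [1⋯ n ] → Unique τ
  τ! perm = Unique-resp-↭ (↭-sym perm) ([1⋯]-Unique n)

  take-++ : ∀ (xs ys : List ℕ) → take (length xs) (xs ++ ys) ≡ xs
  take-++ []       ys = refl
  take-++ (x ∷ xs) ys = cong (x ∷_) (take-++ xs ys)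

theorem6p5 : (n t : ℕ) (c : List ℕ) →
  let σs        = 3412-pattern ∷ 3421-pattern ∷ []
      Exceeding = (∃ λ M → IsMax (U c) M × 1 ≤ missing M c) ⊎ (∃ λ M → IsMax (V c) M × 2 ≤ missing M c)
  in
  3 ≤ n → 1 ≤ t → t < n → length c ≡ t →
  All (_∈ [1⋯ n ]) c → Unique c → All (c Avoids_) σs →
  (Exceeding → HasSize (S n c σs) 0)
  × (¬ Exceeding →
      ∃ λ j → IsMin (λ i → 1 ≤ i × i ≤ t + 1 × 1 < gap n c i) j
            × HasSize (S n c σs)
                (𝕊 (gap n c j ∸ 2) * ∏[ j + 1 ⋯ t + 1 ] (λ i → 𝕊 (gap n c i ∸ 1))))
theorem6p5 n t c _ _ t<n refl c∈ c! avoids = none , some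
  where
  σs : List (List ℕ)
  σs = 3412-pattern ∷ 3421-pattern ∷ []

  Exceeding : Set
  Exceeding = (∃ λ M → IsMax (U c) M × 1 ≤ missing M c) ⊎ (∃ λ M → IsMax (V c) M × 2 ≤ missing M c)

  c⊆ : ∀ {x} → x ∈ c → x ∈ [1⋯ n ]
  c⊆ = All.lookup c∈

  none : Exceeding → HasSize (S n c σs) 0
  none exc = HasSize-∅ λ τ Sτ →
    let adm = Extends⇒Admissible (to (S⇔Extends n c τ) Sτ) in case exc of λ where
      (inj₁ (M , (UM , _) , 1≤)) → <⇒≱ 1≤ (Admissible.threats adm (to (U⇔Threats c M c!) UM))
      (inj₂ (M , (VM , _) , 2≤)) → <⇒≱ 2≤ (Admissible.ascents adm (to (V⇔Ascents c M) VM))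

  U≤n : ∀ x → U c x → x ≤ n
  U≤n x Ux = ∈-[1⋯]⁻ (c⊆ (to∈ (to (U⇔Threats c x c!) Ux .proj₂ .proj₂ .proj₁))) .proj₂

  V≤n : ∀ x → V c x → x ≤ n
  V≤n x Vx = ∈-[1⋯]⁻ (c⊆ (to∈ (to (V⇔Ascents c x) Vx .proj₂ .proj₁))) .proj₂

  admissible : ¬ Exceeding → Admissible c
  admissible ¬exc = record
    -- `≮⇒≥` makes the goal a negation, so the doubly negated maximum `M` may be used; monotonicity
    -- carries the count at `x` up to `M`.
    { ascents = λ {x} a → let Vx = from (V⇔Ascents c x) a in ≮⇒≥ λ 2≤ →
        ¬¬-IsMax n V≤n Vx λ (M , VM , M≥) →
          ¬exc (inj₂ (M , (VM , M≥) , ≤-trans 2≤ (missing-monoˡ (M≥ x Vx))))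
    ; threats = λ {x} a → let Ux = from (U⇔Threats c x c!) a in ≮⇒≥ λ 1≤ →
        ¬¬-IsMax n U≤n Ux λ (M , UM , M≥) →
          ¬exc (inj₁ (M , (UM , M≥) , ≤-trans 1≤ (missing-monoˡ (M≥ x Ux))))
    ; ¬bad = to (avoids⇔¬Bad c c!) avoids
    }

  some : ¬ Exceeding →
    ∃ λ j → IsMin (λ i → 1 ≤ i × i ≤ t + 1 × 1 < gap n c i) j
          × HasSize (S n c σs) (𝕊 (gap n c j ∸ 2) * ∏[ j + 1 ⋯ t + 1 ] (λ i → 𝕊 (gap n c i ∸ 1)))
  some ¬exc = let j , min , eq = completions-formula c! c⊆ t<n in
    j , min , subst (HasSize (S n c σs)) eq
      (HasSize-⇔ (λ τ → mk⇔ (from (S⇔Extends n c τ)) (to (S⇔Extends n c τ)))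
        (count-Extends (missing n c) ≤-refl c! c⊆ (admissible ¬exc)))
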